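{- For integers $n\geq 3$ and $\ell\geq 0$, let $g(n,3,\ell)$ denote the minimum number of edges of a simple graph $G$ of order $n$ with $\lambda_3(G)=\ell$. Then (1) $g(n,3,n-2)=\binom{n}{2}-1$; (2) $g(n,3,n-3)=\binom{n}{2}-\lfloor \frac{n+3}{2}\rfloor$; (3) $g(n,3,1)=n-1$; (4) for $n\geq 11$ and $1\leq \ell\leq n-4$, $g(n,3,\ell)\geq \left\lceil \frac{\ell(\ell+1)}{2\ell+1}\,n\right\rceil$. Moreover, this lower bound is sharp, i.e., there exist $n$ and $\ell$ in this range for which equality holds.
   Context: All graphs are finite, undirected and simple. For $S\subseteq V(G)$ with $|S|\geq 2$, an $S$-tree is a subgraph of $G$ that is a tree containing all vertices of $S$; $\lambda(S)$ is the maximum number of pairwise edge-disjoint $S$-trees in $G$. For $2\leq k\leq n$, the generalized $k$-edge-connectivity is $\lambda_k(G)=\min\{\lambda(S): S\subseteq V(G),\ |S|=k\}$, and $\lambda_k(G)=0$ if $G$ is disconnected. -}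

module Defs where

open import Data.Bool using (Bool; true; false; _∧_; if_then_else_)
open import Data.Nat using (ℕ; zero; suc; _+_; _*_; _∸_; _≤_; _<ᵇ_)
open import Data.Nat.DivMod using (_/_)
open import Data.Fin using (Fin; toℕ)
open import Data.List using (List; []; _∷_; _++_; [_]; length; map; allFin)
open import Data.Nat.ListAction using (sum)
open import Data.List.Relation.Unary.Unique.Propositional using (Unique)
open import Data.List.Relation.Unary.Linked using (Linked)
open import Data.Product using (Σ; _×_; ∃; ∃-syntax)
open import Relation.Binary.PropositionalEquality using (_≡_; _≢_)
open import Relation.Nullary using (¬_)

record Graph (n : ℕ) : Set where
  field
    adj   : Fin n → Fin n → Bool
    sym   : ∀ u v → adj u v ≡ adj v u
    irr   : ∀ v → adj v v ≡ false
open Graph public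

edgeCount : ∀ {n} → Graph n → ℕ
edgeCount {n} G =
  sum (map (λ i → sum (map (λ j → if (toℕ i <ᵇ toℕ j) ∧ adj G i j then 1 else 0)
                           (allFin n)))
           (allFin n))

record Subgraph {n : ℕ} (G : Graph n) : Set where
  field
    vert   : Fin n → Bool
    edge   : Fin n → Fin n → Bool
    esym   : ∀ u v → edge u v ≡ edge v u
    eInG   : ∀ u v → edge u v ≡ true → adj G u v ≡ true
    eVert  : ∀ u v → edge u v ≡ true → vert u ≡ true
open Subgraph public

module _ {n : ℕ} {G : Graph n} (H : Subgraph G) where

  Adj : Fin n → Fin n → Set
  Adj u v = edge H u v ≡ true

  data Walk : Fin n → Fin n → Set where
    here : ∀ {u} → vert H u ≡ true → Walk u u
    step : ∀ {u v w} → Adj u v → Walk v w → Walk u w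

  Connected : Set
  Connected = ∀ u v → vert H u ≡ true → vert H v ≡ true → Walk u v

  Cycle : Fin n → List (Fin n) → Set
  Cycle x xs = (2 ≤ length xs) × Unique (x ∷ xs) × Linked Adj (x ∷ xs ++ [ x ])

  Acyclic : Set
  Acyclic = ∀ x xs → ¬ Cycle x xs

  IsTree : Set
  IsTree = Connected × Acyclic

IsSTree : ∀ {n} {G : Graph n} → Fin n → Fin n → Fin n → Subgraph G → Set
IsSTree a b c T = IsTree T × vert T a ≡ true × vert T b ≡ true × vert T c ≡ true

HasPacking : ∀ {n} → Graph n → Fin n → Fin n → Fin n → ℕ → Set
HasPacking G a b c k =
  Σ (Fin k → Subgraph G) λ T →
    (∀ i → IsSTree a b c (T i)) ×
    (∀ i j → i ≢ j → ∀ u v → edge (T i) u v ≡ true → edge (T j) u v ≡ false)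

Distinct3 : ∀ {n} → Fin n → Fin n → Fin n → Set
Distinct3 a b c = a ≢ b × a ≢ c × b ≢ c

-- λ₃(G) = ℓ, i.e. ℓ = min over |S| = 3 of λ(S), where λ(S) is the maximum
-- number of pairwise edge-disjoint S-trees.  (λ(S) ≥ k iff HasPacking … k.)
Lambda3≡ : ∀ {n} → Graph n → ℕ → Set
Lambda3≡ {n} G ℓ =
  (∀ a b c → Distinct3 a b c → HasPacking G a b c ℓ) ×
  (∃[ a ] ∃[ b ] ∃[ c ] (Distinct3 a b c × ¬ HasPacking G a b c (suc ℓ)))

IsG : ℕ → ℕ → ℕ → Set
IsG n ℓ m =
  (Σ (Graph n) λ G → Lambda3≡ G ℓ × edgeCount G ≡ m) ×
  (∀ (G : Graph n) → Lambda3≡ G ℓ → m ≤ edgeCount G)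

-- ⌈ ℓ(ℓ+1) n / (2ℓ+1) ⌉
bound : ℕ → ℕ → ℕ
bound n ℓ = (ℓ * (ℓ + 1) * n + ℓ + ℓ) / suc (ℓ + ℓ)

{-# OPTIONS --safe #-}

-- Lower bounds.  Give every edge leaving S = {a, b, c} weight 4 and every edge inside S weight 6.
-- Each S-tree then has weight at least 12, so k edge-disjoint S-trees force
--   12 k + 2 e(S) ≤ 4 (d(a) + d(b) + d(c)).
-- For k = n − 2 and k = n − 3 this bounds the sum of three degrees in the complement, and the
-- three largest complement degrees control all the others.  The same argument with S = {u, v}
-- shows that two vertices of degree ℓ = λ₃(G) are never adjacent; counting the edges at such
-- vertices, and all degrees, gives (2ℓ + 1) |E| ≥ ℓ (ℓ + 1) n.
--
-- Extremal graphs.  All of them are complete multipartite: K_{2,1,…,1}, K_{3,2,…,2(,1)}, the star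
-- K_{1,n−1} and K_{5,6}.  A vertex outside the parts meeting S is adjacent to all of S and
-- contributes a star; the remaining trees live in the few parts meeting S.
module Submission where

open import Defs
open import Data.Nat using (ℕ; zero; suc; pred; ⌊_/2⌋; _+_; _*_; _∸_; _≤_; _<_; _/_; _%_; _<ᵇ_; _≡ᵇ_; z≤n; s≤s)
open import Data.Nat.Combinatorics using (_C_; nC1≡n; nCk+nC[k+1]≡[n+1]C[k+1])
open import Data.Product using (Σ; ∃; _×_; _,_; proj₁; proj₂)
open import Data.Bool using (Bool; true; false; _∧_; _∨_; not; if_then_else_)
import Data.Bool as Bool
open import Data.Bool.Properties using (∨-comm; ∨-zeroʳ)
open import Data.Fin using (Fin; zero; suc; toℕ; fromℕ<; inject≤; punchIn; punchOut; splitAt; join; _↑ˡ_; _↑ʳ_)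
open import Data.Fin.Patterns
import Data.Fin.Properties as Fin
open import Data.Fin.Properties using (_≟_)
open import Data.List using (List; []; _∷_; _++_; [_]; length; map; allFin; tabulate; filter; concat; lookup)
open import Data.List.Membership.DecPropositional using (_∈?_)
open import Data.List.Membership.Propositional using (_∈_; _∉_)
open import Data.List.Membership.Propositional.Properties using (∈-++⁻; ∈-++⁺ˡ; ∈-++⁺ʳ; ∈-allFin; ∈-filter⁺; ∈-filter⁻; ∈-concat⁺′; ∈-tabulate⁺; ∈-lookup; ∈-map⁺)
open import Data.List.Properties using (map-tabulate)
open import Data.List.Relation.Unary.All using (All; []; _∷_)
import Data.List.Relation.Unary.All as All
open import Data.List.Relation.Unary.All.Properties using (all-filter)
open import Data.List.Relation.Unary.AllPairs using ([]; _∷_)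
open import Data.List.Relation.Unary.Any using (here; there; index)
open import Data.List.Relation.Unary.Any.Properties using (lookup-index)
open import Data.List.Relation.Unary.Linked using (Linked; []; [-]; _∷_; linked?)
import Data.List.Relation.Unary.Linked as Linked
import Data.List.Relation.Unary.Linked.Properties as Linked
open import Data.List.Relation.Unary.Unique.Propositional using (Unique)
import Data.List.Relation.Unary.Unique.Propositional.Properties as Unique
open import Data.Nat.DivMod using (m<n*o⇒m/o<n; m/n*n≤m; m≡m%n+[m/n]*n; m%n<n)
import Data.Nat.ListAction as ListAction
import Data.Nat.Properties as ℕ
open import Data.Nat.Properties hiding (_≟_)
open import Data.List.Extrema ≤-totalOrder using (argmax; argmax-all; f[xs]≤f[argmax])
open import Algebra.Properties.Semiring.Sum +-*-semiring using (sum; sum-cong-≗; ∑-distrib-+; ∑-comm; *-distribˡ-sum)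
open import Data.Nat.Tactic.RingSolver using (solve-∀)
open import Data.Product.Properties using (≡-dec)
open import Data.Sum using (_⊎_; inj₁; inj₂; [_,_]′)
open import Data.Unit using (⊤; tt)
open import Data.Vec using ([]; _∷_)
import Data.Vec as Vec
open import Function using (_∘_; id)
open import Function.Definitions using (Injective)
open import Relation.Binary.Construct.Closure.ReflexiveTransitive using (Star; ε; _◅_; _◅◅_; reverse)
open import Relation.Binary.Definitions using (DecidableEquality)
open import Relation.Binary.PropositionalEquality using (_≡_; _≢_; ≢-sym; refl; trans; cong; cong₂; subst; subst₂; module ≡-Reasoning) renaming (sym to ≡-sym)
open import Relation.Nullary using (¬_; Dec; yes; no; does; contradiction)
open import Relation.Nullary.Decidable using (_⊎-dec_; _×-dec_; ¬?; True; toWitness)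

-- Sums and degrees

-- The weights sit on the far ends of edges, 3 on S and 4 elsewhere: an edge inside S is met from
-- both ends and counts 3 + 3. This balances the two cheapest kinds of S-tree, a star with its
-- centre outside S and a two-edge path on S, at exactly 12. Equality in the general bound, before
-- rounding, makes every edge join a vertex of degree ℓ to one of degree ℓ + 1. This points to
-- K_{ℓ,ℓ+1}, with n = 2ℓ + 1 and ℓ(ℓ + 1) edges; n ≥ 11 makes ℓ = 5 the first candidate. The
-- obstacle on the constructive side is that S is arbitrary and mostly n is too, so a packing cannot
-- be checked by evaluating the graph. Vertices of the parts meeting S are therefore named by part
-- and position, and literal walks over such names are checked by a decision procedure. Trees are
-- then grown inside the walks leaf by leaf, so acyclicity is proved once, for the addition of a
-- leaf.

[_]ᵇ : Bool → ℕ
[ b ]ᵇ = if b then 1 else 0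

[]ᵇ≤1 : ∀ b → [ b ]ᵇ ≤ 1
[]ᵇ≤1 true  = ≤-refl
[]ᵇ≤1 false = z≤n

δ : ∀ {n} → Fin n → Fin n → ℕ
δ i j = [ does (i ≟ j) ]ᵇ

δ-refl : ∀ {n} (i : Fin n) → δ i i ≡ 1
δ-refl i with i ≟ i
... | yes _   = refl
... | no  i≢i = contradiction refl i≢i

δ-≢ : ∀ {n} {i j : Fin n} → i ≢ j → δ i j ≡ 0
δ-≢ {i = i} {j} i≢j with i ≟ j
... | yes i≡j = contradiction i≡j i≢j
... | no  _   = refl

δ-sym : ∀ {n} (i j : Fin n) → δ i j ≡ δ j i
δ-sym i j with i ≟ j
... | yes refl = ≡-sym (δ-refl i)
... | no  i≢j  = ≡-sym (δ-≢ (i≢j ∘ ≡-sym))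

sum-mono-≤ : ∀ {n} {f g : Fin n → ℕ} → (∀ i → f i ≤ g i) → sum f ≤ sum g
sum-mono-≤ {zero}  f≤g = z≤n
sum-mono-≤ {suc n} f≤g = +-mono-≤ (f≤g zero) (sum-mono-≤ (f≤g ∘ suc))

sum-const : ∀ n c → sum {n} (λ _ → c) ≡ n * c
sum-const zero    c = refl
sum-const (suc n) c = cong (c +_) (sum-const n c)

term≤sum : ∀ {n} (f : Fin n → ℕ) i → f i ≤ sum f
term≤sum f zero    = m≤m+n _ _
term≤sum f (suc i) = m≤n⇒m≤o+n (f zero) (term≤sum (f ∘ suc) i)

two-terms≤sum : ∀ {n} (f : Fin n → ℕ) {i j} → i ≢ j → f i + f j ≤ sum f
two-terms≤sum f {zero}  {zero}  i≢j = contradiction refl i≢j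
two-terms≤sum f {zero}  {suc j} i≢j = +-monoʳ-≤ (f zero) (term≤sum (f ∘ suc) j)
two-terms≤sum f {suc i} {zero}  i≢j = ≤-trans (≤-reflexive (+-comm (f (suc i)) (f zero)))
                                        (+-monoʳ-≤ (f zero) (term≤sum (f ∘ suc) i))
two-terms≤sum f {suc i} {suc j} i≢j = m≤n⇒m≤o+n (f zero) (two-terms≤sum (f ∘ suc) (i≢j ∘ cong suc))

sum-δ-* : ∀ {n} (i : Fin n) (f : Fin n → ℕ) → sum (λ j → δ i j * f j) ≡ f i
sum-δ-* {suc n} zero f = begin
  f zero + 0 + sum {n} (λ _ → 0) ≡⟨ cong₂ _+_ (+-identityʳ _) (trans (sum-const n 0) (*-zeroʳ n)) ⟩
  f zero + 0                     ≡⟨ +-identityʳ _ ⟩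
  f zero                         ∎
  where open ≡-Reasoning
sum-δ-* {suc n} (suc i) f = trans (sum-cong-≗ λ j → cong (_* f (suc j)) (δ-suc j)) (sum-δ-* i (f ∘ suc))
  where
  δ-suc : ∀ j → δ (suc i) (suc j) ≡ δ i j
  δ-suc j with i ≟ j
  ... | yes _ = refl
  ... | no  _ = refl

sum-δ : ∀ {n} (i : Fin n) → sum (δ i) ≡ 1
sum-δ i = trans (sum-cong-≗ λ j → ≡-sym (*-identityʳ (δ i j))) (sum-δ-* i (λ _ → 1))

∑-distrib-+₃ : ∀ {n} (f g h : Fin n → ℕ) → sum (λ i → f i + g i + h i) ≡ sum f + sum g + sum h
∑-distrib-+₃ f g h = trans (∑-distrib-+ (λ i → f i + g i) h) (cong (_+ sum h) (∑-distrib-+ f g))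

sum-map-allFin : ∀ {n} (f : Fin n → ℕ) → ListAction.sum (map f (allFin n)) ≡ sum f
sum-map-allFin {n} f = trans (cong ListAction.sum (map-tabulate id f)) (sum-tabulate f)
  where
  sum-tabulate : ∀ {m} (h : Fin m → ℕ) → ListAction.sum (tabulate h) ≡ sum h
  sum-tabulate {zero}  h = refl
  sum-tabulate {suc m} h = cong (h zero +_) (sum-tabulate (h ∘ suc))

total : ∀ {n} → (Fin n → Fin n → Bool) → ℕ
total E = sum λ i → sum λ j → [ E i j ]ᵇ

deg : ∀ {n} → Graph n → Fin n → ℕ
deg G v = sum λ j → [ adj G v j ]ᵇ

handshake : ∀ {n} (G : Graph n) → sum (deg G) ≡ 2 * edgeCount G
handshake {n} G = begin
  sum (λ i → sum (λ j → [ adj G i j ]ᵇ))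
    ≡⟨ sum-cong-≗ (λ i → trans (sum-cong-≗ (split i)) (∑-distrib-+ (up i) (λ j → up j i))) ⟩
  sum (λ i → sum (up i) + sum (λ j → up j i))
    ≡⟨ ∑-distrib-+ (λ i → sum (up i)) (λ i → sum (λ j → up j i)) ⟩
  U + sum (λ i → sum (λ j → up j i))
    ≡⟨ cong (U +_) (∑-comm (λ i j → up j i)) ⟩
  U + U
    ≡⟨ cong (U +_) (+-identityʳ U) ⟨
  2 * U
    ≡⟨ cong (2 *_) edgeCount-sum ⟨
  2 * edgeCount G ∎
  where
  open ≡-Reasoning
  up : Fin n → Fin n → ℕ
  up i j = [ (toℕ i <ᵇ toℕ j) ∧ adj G i j ]ᵇ
  U : ℕ
  U = sum λ i → sum (up i)
  edgeCount-sum : edgeCount G ≡ U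
  edgeCount-sum = trans (sum-map-allFin (λ i → ListAction.sum (map (up i) (allFin n))))
                        (sum-cong-≗ λ i → sum-map-allFin (up i))
  <ᵇ-cmp : ∀ a b → a ≡ b ⊎ ((a <ᵇ b) ≡ not (b <ᵇ a))
  <ᵇ-cmp zero    zero    = inj₁ refl
  <ᵇ-cmp zero    (suc b) = inj₂ refl
  <ᵇ-cmp (suc a) zero    = inj₂ refl
  <ᵇ-cmp (suc a) (suc b) with <ᵇ-cmp a b
  ... | inj₁ a≡b = inj₁ (cong suc a≡b)
  ... | inj₂ eq  = inj₂ eq
  split : ∀ i j → [ adj G i j ]ᵇ ≡ up i j + up j i
  split i j with <ᵇ-cmp (toℕ i) (toℕ j)
  ... | inj₁ i≡j with refl ← Fin.toℕ-injective i≡j rewrite irr G i with toℕ i <ᵇ toℕ i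
  ...   | true  = refl
  ...   | false = refl
  split i j | inj₂ eq rewrite eq | sym G j i with toℕ j <ᵇ toℕ i
  ...   | true  = refl
  ...   | false = ≡-sym (+-identityʳ _)

-- Growing trees leaf by leaf

_◅◅ʷ_ : ∀ {n} {G : Graph n} {H : Subgraph G} {u v w} → Walk H u v → Walk H v w → Walk H u w
here _   ◅◅ʷ q = q
step e p ◅◅ʷ q = step e (p ◅◅ʷ q)

Linked-∷ʳ⁻ : ∀ {A : Set} {R : A → A → Set} z zs {w} → Linked R (z ∷ zs ++ [ w ]) → ∃ λ p → p ∈ z ∷ zs × R p w
Linked-∷ʳ⁻ z []       (r ∷ _) = z , here refl , r
Linked-∷ʳ⁻ z (y ∷ zs) (_ ∷ l) with Linked-∷ʳ⁻ y zs l
... | p , p∈ , r = p , there p∈ , r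

module _ {n : ℕ} {G : Graph n} (T : Subgraph G) {u v : Fin n}
         (u∈T : vert T u ≡ true) (v∉T : vert T v ≡ false) (u~v : adj G u v ≡ true) where

  private
    V⁺ : Fin n → Bool
    V⁺ x = vert T x ∨ does (x ≟ v)

    link : Fin n → Fin n → Bool
    link x y = (does (x ≟ u) ∧ does (y ≟ v)) ∨ (does (y ≟ u) ∧ does (x ≟ v))

    E⁺ : Fin n → Fin n → Bool
    E⁺ x y = edge T x y ∨ link x y

    link-inv : ∀ x y → link x y ≡ true → (x ≡ u × y ≡ v) ⊎ (x ≡ v × y ≡ u)
    link-inv x y eq with x ≟ u | y ≟ v | y ≟ u | x ≟ v
    ... | yes x≡u | yes y≡v | _       | _       = inj₁ (x≡u , y≡v)
    ... | yes _   | no  _   | yes y≡u | yes x≡v = inj₂ (x≡v , y≡u)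
    ... | no _    | _       | yes y≡u | yes x≡v = inj₂ (x≡v , y≡u)
    link-inv x y () | yes _ | no _ | yes _ | no _
    link-inv x y () | yes _ | no _ | no _  | _
    link-inv x y () | no _  | _    | yes _ | no _
    link-inv x y () | no _  | _    | no _  | _

    E⁺-inv : ∀ x y → E⁺ x y ≡ true → edge T x y ≡ true ⊎ (x ≡ u × y ≡ v) ⊎ (x ≡ v × y ≡ u)
    E⁺-inv x y eq with edge T x y
    ... | true  = inj₁ refl
    ... | false = inj₂ (link-inv x y eq)

    E⁺-old : ∀ x y → edge T x y ≡ true → E⁺ x y ≡ true
    E⁺-old x y eq rewrite eq = refl

    E⁺-sym : ∀ x y → E⁺ x y ≡ E⁺ y x
    E⁺-sym x y = cong₂ _∨_ (esym T x y) (∨-comm (does (x ≟ u) ∧ does (y ≟ v)) _)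

    E⁺-uv : E⁺ u v ≡ true
    E⁺-uv with u ≟ u | v ≟ v
    ... | yes _   | yes _   = ∨-zeroʳ (edge T u v)
    ... | no  u≢u | _       = contradiction refl u≢u
    ... | _       | no  v≢v = contradiction refl v≢v

    E⁺-vu : E⁺ v u ≡ true
    E⁺-vu = trans (E⁺-sym v u) E⁺-uv

    V⁺-old : ∀ x → vert T x ≡ true → V⁺ x ≡ true
    V⁺-old x eq rewrite eq = refl

    V⁺-v : V⁺ v ≡ true
    V⁺-v with v ≟ v
    ... | yes _   = ∨-zeroʳ (vert T v)
    ... | no  v≢v = contradiction refl v≢v

    V⁺-inv : ∀ x → V⁺ x ≡ true → vert T x ≡ true ⊎ x ≡ v
    V⁺-inv x eq with vert T x | x ≟ v
    ... | true  | _       = inj₁ refl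
    ... | false | yes x≡v = inj₂ x≡v
    V⁺-inv x () | false | no _

    E⁺-vert : ∀ x y → E⁺ x y ≡ true → V⁺ x ≡ true
    E⁺-vert x y eq with E⁺-inv x y eq
    ... | inj₁ e                    = V⁺-old x (eVert T x y e)
    ... | inj₂ (inj₁ (refl , refl)) = V⁺-old u u∈T
    ... | inj₂ (inj₂ (refl , refl)) = V⁺-v

    E⁺-inG : ∀ x y → E⁺ x y ≡ true → adj G x y ≡ true
    E⁺-inG x y eq with E⁺-inv x y eq
    ... | inj₁ e                    = eInG T x y e
    ... | inj₂ (inj₁ (refl , refl)) = u~v
    ... | inj₂ (inj₂ (refl , refl)) = trans (sym G v u) u~v

    v-isolated : ∀ x → edge T v x ≡ false
    v-isolated x with edge T v x in eq
    ... | false = refl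
    ... | true  = contradiction (trans (≡-sym (eVert T v x eq)) v∉T) λ ()

  addLeaf : Subgraph G
  addLeaf = record { vert = V⁺ ; edge = E⁺ ; esym = E⁺-sym ; eInG = E⁺-inG ; eVert = E⁺-vert }

  addLeaf-vert : ∀ x → vert T x ≡ true → vert addLeaf x ≡ true
  addLeaf-vert = V⁺-old

  addLeaf-leaf : vert addLeaf v ≡ true
  addLeaf-leaf = V⁺-v

  addLeaf-edge⁻ : ∀ x y → edge addLeaf x y ≡ true → edge T x y ≡ true ⊎ (x ≡ u × y ≡ v) ⊎ (x ≡ v × y ≡ u)
  addLeaf-edge⁻ = E⁺-inv

  private
    lift : ∀ {x y} → Walk T x y → Walk addLeaf x y
    lift (here x∈)  = here (V⁺-old _ x∈)
    lift (step e w) = step (E⁺-old _ _ e) (lift w)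

  addLeaf-connected : Connected T → Connected addLeaf
  addLeaf-connected conn x y x∈ y∈ = to-u x∈ ◅◅ʷ from-u y∈
    where
    to-u : ∀ {x} → V⁺ x ≡ true → Walk addLeaf x u
    to-u {x} x∈ with V⁺-inv x x∈
    ... | inj₁ x∈T = lift (conn x u x∈T u∈T)
    ... | inj₂ refl = step E⁺-vu (here (V⁺-old u u∈T))
    from-u : ∀ {y} → V⁺ y ≡ true → Walk addLeaf u y
    from-u {y} y∈ with V⁺-inv y y∈
    ... | inj₁ y∈T = lift (conn u y u∈T y∈T)
    ... | inj₂ refl = step E⁺-uv (here V⁺-v)

  private
    nbr-of-leaf : ∀ x → E⁺ v x ≡ true → x ≡ u
    nbr-of-leaf x eq with E⁺-inv v x eq
    ... | inj₁ e                = contradiction (trans (≡-sym e) (v-isolated x)) λ ()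
    ... | inj₂ (inj₁ (refl , _)) = contradiction (trans (≡-sym u∈T) v∉T) λ ()
    ... | inj₂ (inj₂ (_ , x≡u)) = x≡u

    nbr-of-leaf′ : ∀ x → E⁺ x v ≡ true → x ≡ u
    nbr-of-leaf′ x eq = nbr-of-leaf x (trans (E⁺-sym v x) eq)

    avoiding : ∀ xs → v ∉ xs → Linked (Adj addLeaf) xs → Linked (Adj T) xs
    avoiding []           _  _       = []
    avoiding (x ∷ [])     _  _       = [-]
    avoiding (x ∷ y ∷ xs) v∉ (e ∷ l) with E⁺-inv x y e
    ... | inj₁ e′                 = e′ ∷ avoiding (y ∷ xs) (v∉ ∘ there) l
    ... | inj₂ (inj₁ (_ , refl)) = contradiction (there (here refl)) v∉
    ... | inj₂ (inj₂ (refl , _)) = contradiction (here refl) v∉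

    -- A path cannot pass through the leaf, since it would visit u just before and just after.
    no-pass : ∀ p ys q → p ≢ q → q ∉ ys → Unique (p ∷ ys) → Linked (Adj addLeaf) (p ∷ ys ++ [ q ]) → v ∉ ys
    no-pass p (_ ∷ [])     q p≢q q∉ _ (e ∷ e′ ∷ _) (here refl) =
      p≢q (trans (nbr-of-leaf′ p e) (≡-sym (nbr-of-leaf q e′)))
    no-pass p (_ ∷ y ∷ ys) q p≢q q∉ ((_ ∷ p≢y ∷ _) ∷ _) (e ∷ e′ ∷ _) (here refl) =
      p≢y (trans (nbr-of-leaf′ p e) (≡-sym (nbr-of-leaf y e′)))
    no-pass p (y ∷ ys)     q p≢q q∉ (_ ∷ uniq) (_ ∷ l) (there v∈) =
      no-pass y ys q (λ { refl → q∉ (here refl) }) (q∉ ∘ there) uniq l v∈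

  -- The only neighbour of `v` is `u`, while on a cycle the vertices just before and just after `v`
  -- are distinct. Whether `v` is the base point, the second vertex or a later one, this is
  -- contradictory, so every cycle avoids `v` and already lies in `T`.
  addLeaf-acyclic : Acyclic T → Acyclic addLeaf
  addLeaf-acyclic acyc x []       (() , _)
  addLeaf-acyclic acyc x (y ∷ []) (s≤s () , _)
  addLeaf-acyclic acyc x xs@(y ∷ z ∷ zs) (2≤ , uniq@((x≢y ∷ x≢z ∷ x∉) ∷ uniq′@((y≢z ∷ y∉) ∷ uniq″)) , l@(e ∷ l′@(e′ ∷ l″))) =
    acyc x xs (2≤ , uniq , avoiding (x ∷ xs ++ [ x ]) v∉ l)
    where
    x≢v : v ≢ x
    x≢v refl with Linked-∷ʳ⁻ z zs l″
    ... | p , p∈ , e″ = All.lookup (y≢z ∷ y∉) p∈ (trans (nbr-of-leaf y e) (≡-sym (nbr-of-leaf′ p e″)))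
    y≢v : v ≢ y
    y≢v refl = x≢z (trans (nbr-of-leaf′ x e) (≡-sym (nbr-of-leaf z e′)))
    v∉tail : v ∉ z ∷ zs
    v∉tail = no-pass y (z ∷ zs) x (x≢y ∘ ≡-sym) (λ x∈ → All.lookup (x≢z ∷ x∉) x∈ refl) uniq′ l′
    v∉ : v ∉ x ∷ xs ++ [ x ]
    v∉ (here v≡x) = x≢v v≡x
    v∉ (there (here v≡y)) = y≢v v≡y
    v∉ (there (there v∈)) with ∈-++⁻ (z ∷ zs) v∈
    ... | inj₁ v∈tail     = v∉tail v∈tail
    ... | inj₂ (here v≡x) = x≢v v≡x

  addLeaf-order : sum (λ x → [ vert addLeaf x ]ᵇ) ≤ 1 + sum (λ x → [ vert T x ]ᵇ)
  addLeaf-order = begin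
    sum (λ x → [ V⁺ x ]ᵇ)                      ≤⟨ sum-mono-≤ pointwise ⟩
    sum (λ x → δ v x + [ vert T x ]ᵇ)          ≡⟨ ∑-distrib-+ (δ v) _ ⟩
    sum (δ v) + sum (λ x → [ vert T x ]ᵇ)      ≡⟨ cong (_+ _) (sum-δ v) ⟩
    1 + sum (λ x → [ vert T x ]ᵇ)              ∎
    where
    open ≤-Reasoning
    pointwise : ∀ x → [ V⁺ x ]ᵇ ≤ δ v x + [ vert T x ]ᵇ
    pointwise x rewrite δ-sym v x with vert T x | x ≟ v
    ... | true  | yes _ = s≤s z≤n
    ... | true  | no  _ = ≤-refl
    ... | false | yes _ = ≤-refl
    ... | false | no  _ = ≤-refl

  -- The ordered pairs (u, v) and (v, u) are both new, since `v` is isolated in `T`. Together with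
  -- `addLeaf-order` this preserves the invariant `order≤`.
  addLeaf-size : 2 + total (edge T) ≤ total (edge addLeaf)
  addLeaf-size = begin
    2 + total (edge T)
      ≡⟨ cong (_+ total (edge T)) (cong₂ _+_ (∑∑δδ u v) (∑∑δδ v u)) ⟨
    sum (λ x → sum λ y → δ u x * δ v y) + sum (λ x → sum λ y → δ v x * δ u y) + total (edge T)
      ≡⟨ ∑-distrib-+₃ _ _ (λ x → sum λ y → [ edge T x y ]ᵇ) ⟨
    sum (λ x → sum (λ y → δ u x * δ v y) + sum (λ y → δ v x * δ u y) + sum (λ y → [ edge T x y ]ᵇ))
      ≡⟨ sum-cong-≗ (λ x → ∑-distrib-+₃ (λ y → δ u x * δ v y) (λ y → δ v x * δ u y) (λ y → [ edge T x y ]ᵇ)) ⟨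
    sum (λ x → sum (λ y → δ u x * δ v y + δ v x * δ u y + [ edge T x y ]ᵇ))
      ≤⟨ sum-mono-≤ (λ x → sum-mono-≤ (pointwise x)) ⟩
    total E⁺ ∎
    where
    open ≤-Reasoning
    ∑∑δδ : ∀ a b → sum (λ x → sum λ y → δ a x * δ b y) ≡ 1
    ∑∑δδ a b = trans (sum-cong-≗ λ x → trans (≡-sym (*-distribˡ-sum (δ a x) (δ b)))
                                             (cong (δ a x *_) (sum-δ b)))
                     (sum-δ-* a (λ _ → 1))
    u≢v : u ≢ v
    u≢v refl = contradiction (trans (≡-sym u∈T) v∉T) λ ()
    pointwise : ∀ x y → δ u x * δ v y + δ v x * δ u y + [ edge T x y ]ᵇ ≤ [ E⁺ x y ]ᵇ
    pointwise x y with u ≟ x | v ≟ y | v ≟ x | u ≟ y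
    ... | yes refl | yes refl | yes eq  | _       = contradiction (≡-sym eq) u≢v
    ... | yes refl | yes refl | no _    | _       rewrite E⁺-uv | esym T u v | v-isolated u = ≤-refl
    ... | yes refl | no _     | yes eq  | _       = contradiction (≡-sym eq) u≢v
    ... | yes refl | no _     | no _    | _       = []ᵇ-mono u y
      where
      []ᵇ-mono : ∀ x y → [ edge T x y ]ᵇ ≤ [ E⁺ x y ]ᵇ
      []ᵇ-mono x y with edge T x y
      ... | true  = ≤-refl
      ... | false = z≤n
    ... | no _     | _        | yes refl | yes refl rewrite E⁺-vu | v-isolated u = ≤-refl
    ... | no _     | _        | yes refl | no _     rewrite v-isolated y = z≤n
    ... | no _     | _        | no _     | _        with edge T x y
    ...   | true  = ≤-refl
    ...   | false = z≤n

-- The last field records |V(T)| ≤ |E(T)| + 1, with every edge counted in both directions.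
record Grown {n : ℕ} (G : Graph n) (R : Fin n → Fin n → Set) : Set where
  field
    tree    : Subgraph G
    isTree  : IsTree tree
    within  : ∀ x y → edge tree x y ≡ true → R x y
    order≤  : 2 * sum (λ x → [ vert tree x ]ᵇ) ≤ 2 + total (edge tree)

open Grown

module _ {n : ℕ} {G : Graph n} {R : Fin n → Fin n → Set}
         (R-sym : ∀ {x y} → R x y → R y x) (R⊆G : ∀ {x y} → R x y → adj G x y ≡ true) where

  seed : (a : Fin n) → Σ (Grown G R) λ S → vert (tree S) a ≡ true
  seed a = record
    { tree   = point
    ; isTree = connected , λ { x [] (() , _) ; x (y ∷ ys) (_ , _ , () ∷ _) }
    ; within = λ _ _ ()
    ; order≤ = ≤-trans (≤-reflexive (cong (2 *_) (sum-δ a))) (m≤m+n 2 _)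
    } , a∈
    where
    point : Subgraph G
    point = record { vert = λ x → does (a ≟ x) ; edge = λ _ _ → false ; esym = λ _ _ → refl
                   ; eInG = λ _ _ () ; eVert = λ _ _ () }
    a∈ : does (a ≟ a) ≡ true
    a∈ with a ≟ a
    ... | yes _   = refl
    ... | no  a≢a = contradiction refl a≢a
    connected : Connected point
    connected u v u∈ v∈ with a ≟ u | a ≟ v
    ... | yes refl | yes refl = here a∈
    connected u v () v∈ | no _  | _
    connected u v u∈ () | yes _ | no _

  -- Follows the path and attaches a leaf only on reaching a vertex not yet in the tree; steps
  -- between old vertices add no edge. The path may thus revisit vertices without creating a cycle.
  grow : (S : Grown G R) {x y : Fin n} → vert (tree S) x ≡ true → Star R x y →
         Σ (Grown G R) λ S′ → (∀ z → vert (tree S) z ≡ true → vert (tree S′) z ≡ true) × vert (tree S′) y ≡ true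
  grow S x∈ ε = S , (λ _ z∈ → z∈) , x∈
  grow S {x} x∈ (_◅_ {j = v} r rs) with vert (tree S) v in v∈?
  ... | true  = grow S v∈? rs
  ... | false with grow S⁺ (addLeaf-leaf (tree S) x∈ v∈? (R⊆G r)) rs
    where
    T⁺ = addLeaf (tree S) x∈ v∈? (R⊆G r)
    inR : ∀ p q → edge T⁺ p q ≡ true → R p q
    inR p q e with addLeaf-edge⁻ (tree S) x∈ v∈? (R⊆G r) p q e
    ... | inj₁ e′                   = within S p q e′
    ... | inj₂ (inj₁ (refl , refl)) = r
    ... | inj₂ (inj₂ (refl , refl)) = R-sym r
    S⁺ : Grown G R
    S⁺ = record
      { tree   = T⁺
      ; isTree = addLeaf-connected (tree S) x∈ v∈? (R⊆G r) (proj₁ (isTree S))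
               , addLeaf-acyclic (tree S) x∈ v∈? (R⊆G r) (proj₂ (isTree S))
      ; within = inR
      ; order≤ = begin
          2 * sum (λ z → [ vert T⁺ z ]ᵇ)             ≤⟨ *-monoʳ-≤ 2 (addLeaf-order (tree S) x∈ v∈? (R⊆G r)) ⟩
          2 * (1 + sum (λ z → [ vert (tree S) z ]ᵇ)) ≡⟨ *-distribˡ-+ 2 1 _ ⟩
          2 + 2 * sum (λ z → [ vert (tree S) z ]ᵇ)   ≤⟨ +-monoʳ-≤ 2 (order≤ S) ⟩
          2 + (2 + total (edge (tree S)))            ≤⟨ +-monoʳ-≤ 2 (addLeaf-size (tree S) x∈ v∈? (R⊆G r)) ⟩
          2 + total (edge T⁺)                        ∎
      }
      where open ≤-Reasoning
  ...   | S′ , keep , y∈ = S′ , (λ z z∈ → keep z (addLeaf-vert (tree S) x∈ v∈? (R⊆G r) z z∈)) , y∈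

  grow-all : (a : Fin n) (xs : List (Fin n)) → (∀ {x} → x ∈ xs → Star R a x) →
             Σ (Grown G R) λ S → vert (tree S) a ≡ true × (∀ {x} → x ∈ xs → vert (tree S) x ≡ true)
  grow-all a []       _     with seed a
  ... | S , a∈ = S , a∈ , λ ()
  grow-all a (x ∷ xs) reach with grow-all a xs (reach ∘ there)
  ... | S , a∈ , xs∈ with grow S a∈ (reach (here refl))
  ...   | S′ , keep , x∈ = S′ , keep a a∈ , λ { (here refl) → x∈ ; (there z∈) → keep _ (xs∈ z∈) }

-- The i-th tree is grown inside `R i`, so disjointness of the relations becomes edge-disjointness
-- of the trees. Only connections have to be supplied, never trees.
packing-from-connections : ∀ {n k} {G : Graph n} {a b c : Fin n} (R : Fin k → Fin n → Fin n → Set) →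
  (∀ i {x y} → R i x y → R i y x) →
  (∀ i {x y} → R i x y → adj G x y ≡ true) →
  (∀ {i j x y} → R i x y → R j x y → i ≡ j) →
  (∀ i → Star (R i) a b) → (∀ i → Star (R i) a c) → HasPacking G a b c k
packing-from-connections {n} {k} {G} {a} {b} {c} R R-sym R⊆G R-disj a→b a→c =
  (λ i → tree (proj₁ (T i))) ,
  (λ i → isTree (proj₁ (T i)) , proj₁ (proj₂ (T i)) , proj₂ (proj₂ (T i)) (here refl) , proj₂ (proj₂ (T i)) (there (here refl))) ,
  disjoint
  where
  reach : ∀ i {x} → x ∈ b ∷ c ∷ [] → Star (R i) a x
  reach i (here refl)         = a→b i
  reach i (there (here refl)) = a→c i
  T : ∀ i → Σ (Grown G (R i)) λ S → vert (tree S) a ≡ true × (∀ {x} → x ∈ b ∷ c ∷ [] → vert (tree S) x ≡ true)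
  T i = grow-all (R-sym i) (R⊆G i) a (b ∷ c ∷ []) (reach i)
  disjoint : ∀ i j → i ≢ j → ∀ u v → edge (tree (proj₁ (T i))) u v ≡ true → edge (tree (proj₁ (T j))) u v ≡ false
  disjoint i j i≢j u v e with edge (tree (proj₁ (T j))) u v in e′
  ... | false = refl
  ... | true  = contradiction (R-disj (within (proj₁ (T i)) u v e) (within (proj₁ (T j)) u v e′)) i≢j

-- Growing towards all vertices gives a spanning tree, for which `order≤` reads 2(n + 1) ≤ 2 + 2|E|.
connected⇒n≤edges : ∀ {n} (G : Graph (suc n)) → (∀ v → Star (λ x y → adj G x y ≡ true) zero v) → n ≤ edgeCount G
connected⇒n≤edges {n} G reach = *-cancelˡ-≤ 2 (+-cancelˡ-≤ 2 _ _ (begin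
  2 + 2 * n                                  ≡⟨ *-distribˡ-+ 2 1 n ⟨
  2 * suc n                                  ≡⟨ cong (2 *_) (trans (sum-const (suc n) 1) (*-identityʳ (suc n))) ⟨
  2 * sum {suc n} (λ _ → 1)                  ≤⟨ *-monoʳ-≤ 2 (sum-mono-≤ spanning) ⟩
  2 * sum (λ x → [ vert (tree S) x ]ᵇ)       ≤⟨ order≤ S ⟩
  2 + total (edge (tree S))                  ≤⟨ +-monoʳ-≤ 2 (sum-mono-≤ λ x → sum-mono-≤ (edge≤adj x)) ⟩
  2 + total (adj G)                          ≡⟨ cong (2 +_) (handshake G) ⟩
  2 + 2 * edgeCount G                        ∎))
  where
  open ≤-Reasoning
  grown = grow-all {G = G} (λ {x} {y} e → trans (sym G y x) e) id zero (allFin (suc n)) (λ {x} _ → reach x)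
  S = proj₁ grown
  spanning : ∀ x → 1 ≤ [ vert (tree S) x ]ᵇ
  spanning x rewrite proj₂ (proj₂ grown) (∈-allFin x) = ≤-refl
  edge≤adj : ∀ x y → [ edge (tree S) x y ]ᵇ ≤ [ adj G x y ]ᵇ
  edge≤adj x y with edge (tree S) x y in e
  ... | false = z≤n
  ... | true rewrite within S x y e = ≤-refl

-- Edge weights carried by a packing

-- The weight belongs to the far end of an edge. Summed over `s` in S, an edge leaving S is charged
-- once and an edge inside S twice, so different charges for the two kinds come from a function of
-- vertices alone.
wdeg : ∀ {n} → (Fin n → ℕ) → (Fin n → Fin n → Bool) → Fin n → ℕ
wdeg w E s = sum λ j → w j * [ E s j ]ᵇ

wdeg-one : ∀ {n} (E : Fin n → Fin n → Bool) s → wdeg (λ _ → 1) E s ≡ sum (λ j → [ E s j ]ᵇ)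
wdeg-one E s = sum-cong-≗ λ j → *-identityˡ [ E s j ]ᵇ

-- Returns from weights to ordinary degrees. In both uses `r` is the indicator of S, so its weighted
-- degrees over S add up to twice the number of edges inside S.
wdeg-complement : ∀ {n} m (r : Fin n → ℕ) (E : Fin n → Fin n → Bool) s → (∀ j → r j ≤ m) →
  wdeg (λ j → m ∸ r j) E s + wdeg r E s ≡ m * sum (λ j → [ E s j ]ᵇ)
wdeg-complement m r E s r≤m = begin
  wdeg (λ j → m ∸ r j) E s + wdeg r E s               ≡⟨ ∑-distrib-+ (λ j → (m ∸ r j) * [ E s j ]ᵇ) _ ⟨
  sum (λ j → (m ∸ r j) * [ E s j ]ᵇ + r j * [ E s j ]ᵇ) ≡⟨ sum-cong-≗ (λ j → *-distribʳ-+ [ E s j ]ᵇ (m ∸ r j) (r j)) ⟨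
  sum (λ j → (m ∸ r j + r j) * [ E s j ]ᵇ)            ≡⟨ sum-cong-≗ (λ j → cong (_* [ E s j ]ᵇ) (m∸n+n≡m (r≤m j))) ⟩
  sum (λ j → m * [ E s j ]ᵇ)                          ≡⟨ *-distribˡ-sum m (λ j → [ E s j ]ᵇ) ⟨
  m * sum (λ j → [ E s j ]ᵇ)                          ∎
  where open ≡-Reasoning

wdeg-δ₂ : ∀ {n} (E : Fin n → Fin n → Bool) s u v → wdeg (λ j → δ u j + δ v j) E s ≡ [ E s u ]ᵇ + [ E s v ]ᵇ
wdeg-δ₂ E s u v = begin
  sum (λ j → (δ u j + δ v j) * [ E s j ]ᵇ)               ≡⟨ sum-cong-≗ (λ j → *-distribʳ-+ [ E s j ]ᵇ (δ u j) (δ v j)) ⟩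
  sum (λ j → δ u j * [ E s j ]ᵇ + δ v j * [ E s j ]ᵇ)    ≡⟨ ∑-distrib-+ (λ j → δ u j * [ E s j ]ᵇ) _ ⟩
  wdeg (δ u) E s + wdeg (δ v) E s                        ≡⟨ cong₂ _+_ (sum-δ-* u _) (sum-δ-* v _) ⟩
  [ E s u ]ᵇ + [ E s v ]ᵇ                                ∎
  where open ≡-Reasoning

wdeg-δ₃ : ∀ {n} (E : Fin n → Fin n → Bool) s a b c →
  wdeg (λ j → δ a j + δ b j + δ c j) E s ≡ [ E s a ]ᵇ + [ E s b ]ᵇ + [ E s c ]ᵇ
wdeg-δ₃ E s a b c = begin
  sum (λ j → (δ a j + δ b j + δ c j) * [ E s j ]ᵇ)                 ≡⟨ sum-cong-≗ (λ j → *-distribʳ-+ [ E s j ]ᵇ (δ a j + δ b j) (δ c j)) ⟩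
  sum (λ j → (δ a j + δ b j) * [ E s j ]ᵇ + δ c j * [ E s j ]ᵇ)    ≡⟨ ∑-distrib-+ (λ j → (δ a j + δ b j) * [ E s j ]ᵇ) _ ⟩
  wdeg (λ j → δ a j + δ b j) E s + wdeg (δ c) E s                  ≡⟨ cong₂ _+_ (wdeg-δ₂ E s a b) (sum-δ-* c _) ⟩
  [ E s a ]ᵇ + [ E s b ]ᵇ + [ E s c ]ᵇ                             ∎
  where open ≡-Reasoning

module _ {n : ℕ} (w : Fin n → ℕ) (E : Fin n → Fin n → Bool) {s : Fin n} where

  private
    term : ∀ {j} → E s j ≡ true → w j ≤ w j * [ E s j ]ᵇ
    term {j} e rewrite e = ≤-reflexive (≡-sym (*-identityʳ (w j)))

  wdeg-edge : ∀ {j} → E s j ≡ true → w j ≤ wdeg w E s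
  wdeg-edge {j} e = ≤-trans (term e) (term≤sum (λ i → w i * [ E s i ]ᵇ) j)

  wdeg-edges : ∀ {i j} → i ≢ j → E s i ≡ true → E s j ≡ true → w i + w j ≤ wdeg w E s
  wdeg-edges i≢j e e′ = ≤-trans (+-mono-≤ (term e) (term e′)) (two-terms≤sum (λ i → w i * [ E s i ]ᵇ) i≢j)

crossing : ∀ {n} {G : Graph n} {H : Subgraph G} {P : Fin n → Set} → (∀ x → Dec (P x)) →
           ∀ {x y} → Walk H x y → P x → ¬ P y → ∃ λ p → ∃ λ q → P p × ¬ P q × edge H p q ≡ true
crossing P? (here _) px ¬py = contradiction px ¬py
crossing P? (step {u} {v} e w) px ¬py with P? v
... | yes pv = crossing P? w pv ¬py
... | no ¬pv = u , v , px , ¬pv , e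

disjoint-sum : ∀ {k} (f : Fin k → Bool) b → (∀ i → f i ≡ true → b ≡ true) →
               (∀ i j → i ≢ j → f i ≡ true → f j ≡ false) → sum (λ i → [ f i ]ᵇ) ≤ [ b ]ᵇ
disjoint-sum {zero}  f b f⇒b disj = z≤n
disjoint-sum {suc k} f b f⇒b disj with f zero in eq
... | false = disjoint-sum (f ∘ suc) b (f⇒b ∘ suc) (λ i j i≢j → disj (suc i) (suc j) (i≢j ∘ Fin.suc-injective))
... | true rewrite f⇒b zero eq = s≤s (≤-reflexive (begin
  sum (λ i → [ f (suc i) ]ᵇ) ≡⟨ sum-cong-≗ (λ i → cong [_]ᵇ (disj zero (suc i) (λ ()) eq)) ⟩
  sum {k} (λ _ → 0)          ≡⟨ sum-const k 0 ⟩
  k * 0                      ≡⟨ *-zeroʳ k ⟩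
  0                          ∎))
  where open ≡-Reasoning

module _ {n k : ℕ} {G : Graph n} (T : Fin k → Subgraph G)
         (disj : ∀ i j → i ≢ j → ∀ u v → edge (T i) u v ≡ true → edge (T j) u v ≡ false)
         (w : Fin n → ℕ) where

  -- After exchanging the sums, the weight of `j` is charged at most once, because at most one tree
  -- contains the edge from `s` to `j`.
  load : ∀ s → sum (λ i → wdeg w (edge (T i)) s) ≤ wdeg w (adj G) s
  load s = begin
    sum (λ i → sum λ j → w j * [ edge (T i) s j ]ᵇ)  ≡⟨ ∑-comm (λ i j → w j * [ edge (T i) s j ]ᵇ) ⟩
    sum (λ j → sum λ i → w j * [ edge (T i) s j ]ᵇ)  ≡⟨ sum-cong-≗ (λ j → *-distribˡ-sum (w j) (λ i → [ edge (T i) s j ]ᵇ)) ⟨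
    sum (λ j → w j * sum λ i → [ edge (T i) s j ]ᵇ)  ≤⟨ sum-mono-≤ (λ j → *-monoʳ-≤ (w j) (once j)) ⟩
    wdeg w (adj G) s                                 ∎
    where
    open ≤-Reasoning
    once : ∀ j → sum (λ i → [ edge (T i) s j ]ᵇ) ≤ [ adj G s j ]ᵇ
    once j = disjoint-sum (λ i → edge (T i) s j) (adj G s j) (λ i → eInG (T i) s j) (λ i i′ i≢i′ → disj i i′ i≢i′ s j)

  load₂ : ∀ m u v → (∀ i → m ≤ wdeg w (edge (T i)) u + wdeg w (edge (T i)) v) →
          k * m ≤ wdeg w (adj G) u + wdeg w (adj G) v
  load₂ m u v h = begin
    k * m                                                       ≡⟨ sum-const k m ⟨
    sum {k} (λ _ → m)                                           ≤⟨ sum-mono-≤ h ⟩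
    sum (λ i → wdeg w (edge (T i)) u + wdeg w (edge (T i)) v)   ≡⟨ ∑-distrib-+ (λ i → wdeg w (edge (T i)) u) _ ⟩
    sum (λ i → wdeg w (edge (T i)) u) + sum (λ i → wdeg w (edge (T i)) v) ≤⟨ +-mono-≤ (load u) (load v) ⟩
    wdeg w (adj G) u + wdeg w (adj G) v                         ∎
    where open ≤-Reasoning

  load₃ : ∀ m a b c → (∀ i → m ≤ wdeg w (edge (T i)) a + wdeg w (edge (T i)) b + wdeg w (edge (T i)) c) →
          k * m ≤ wdeg w (adj G) a + wdeg w (adj G) b + wdeg w (adj G) c
  load₃ m a b c h = begin
    k * m                                                       ≡⟨ sum-const k m ⟨
    sum {k} (λ _ → m)                                           ≤⟨ sum-mono-≤ h ⟩
    sum (λ i → D i a + D i b + D i c)                           ≡⟨ ∑-distrib-+₃ (λ i → D i a) (λ i → D i b) (λ i → D i c) ⟩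
    sum (λ i → D i a) + sum (λ i → D i b) + sum (λ i → D i c)   ≤⟨ +-mono-≤ (+-mono-≤ (load a) (load b)) (load c) ⟩
    wdeg w (adj G) a + wdeg w (adj G) b + wdeg w (adj G) c      ∎
    where
    open ≤-Reasoning
    D : Fin k → Fin n → ℕ
    D i = wdeg w (edge (T i))

neighbour : ∀ {n} {G : Graph n} {T : Subgraph G} → Connected T → ∀ {x y} → vert T x ≡ true → vert T y ≡ true →
            x ≢ y → ∃ λ q → q ≢ x × edge T x q ≡ true
neighbour conn {x} {y} x∈ y∈ x≢y with crossing (λ z → z ≟ x) (conn x y x∈ y∈) refl (x≢y ∘ ≡-sym)
... | _ , q , refl , q≢x , e = q , q≢x , e

-- Every tree must leave `a` to reach `b`, along an edge of its own. This supplies all the upper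
-- bounds on λ₃ of the extremal graphs.
packing≤deg : ∀ {n k} {G : Graph n} {a b c} → HasPacking G a b c k → a ≢ b → k ≤ deg G a
packing≤deg {n} {k} {G} {a} (T , st , disj) a≢b = begin
  k                                              ≡⟨ *-identityʳ k ⟨
  k * 1                                          ≡⟨ sum-const k 1 ⟨
  sum {k} (λ _ → 1)                              ≤⟨ sum-mono-≤ touches ⟩
  sum (λ i → wdeg (λ _ → 1) (edge (T i)) a)      ≤⟨ load T disj (λ _ → 1) a ⟩
  wdeg (λ _ → 1) (adj G) a                       ≡⟨ wdeg-one (adj G) a ⟩
  deg G a                                        ∎
  where
  open ≤-Reasoning
  touches : ∀ i → 1 ≤ wdeg (λ _ → 1) (edge (T i)) a
  touches i with st i
  ... | (conn , _) , a∈ , b∈ , _ with neighbour conn a∈ b∈ a≢b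
  ...   | _ , _ , e = wdeg-edge (λ _ → 1) (edge (T i)) e

≡false⇒≢true : ∀ {b} → b ≡ false → b ≢ true
≡false⇒≢true refl ()

-- With far-end weight 1 on `u`, `v` and 2 elsewhere, each edge meeting {u, v} weighs 2. A tree has
-- at least two such edges: without the edge uv it needs separate edges at `u` and `v`, and with it
-- another one towards `c`. The graph offers d(u) + d(v) - [uv] of them.
packing-pair-bound : ∀ {n k} {G : Graph n} {u v c} → HasPacking G u v c k → Distinct3 u v c →
                     k * 4 + 2 * [ adj G u v ]ᵇ ≤ 2 * (deg G u + deg G v)
packing-pair-bound {n} {k} {G} {u} {v} {c} (T , st , disj) (u≢v , u≢c , v≢c) = begin
  k * 4 + 2 * [ adj G u v ]ᵇ
    ≤⟨ +-mono-≤ (load₂ T disj w 4 u v heavy) (≤-reflexive inner) ⟩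
  wdeg w (adj G) u + wdeg w (adj G) v + (wdeg r (adj G) u + wdeg r (adj G) v)
    ≡⟨ interchange (wdeg w (adj G) u) _ _ _ ⟩
  (wdeg w (adj G) u + wdeg r (adj G) u) + (wdeg w (adj G) v + wdeg r (adj G) v)
    ≡⟨ cong₂ _+_ (wdeg-complement 2 r (adj G) u r≤2) (wdeg-complement 2 r (adj G) v r≤2) ⟩
  2 * deg G u + 2 * deg G v
    ≡⟨ *-distribˡ-+ 2 (deg G u) (deg G v) ⟨
  2 * (deg G u + deg G v) ∎
  where
  open ≤-Reasoning
  interchange : ∀ p q r s → p + q + (r + s) ≡ (p + r) + (q + s)
  interchange = solve-∀
  r w : Fin n → ℕ
  r j = δ u j + δ v j
  w j = 2 ∸ r j
  r≤2 : ∀ j → r j ≤ 2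
  r≤2 j = +-mono-≤ ([]ᵇ≤1 (does (u ≟ j))) ([]ᵇ≤1 (does (v ≟ j)))
  w-u : w u ≡ 1
  w-u rewrite δ-refl u | δ-≢ (u≢v ∘ ≡-sym) = refl
  w-v : w v ≡ 1
  w-v rewrite δ-refl v | δ-≢ u≢v = refl
  w-out : ∀ {q} → q ≢ u → q ≢ v → w q ≡ 2
  w-out q≢u q≢v rewrite δ-≢ (q≢u ∘ ≡-sym) | δ-≢ (q≢v ∘ ≡-sym) = refl
  inner : 2 * [ adj G u v ]ᵇ ≡ wdeg r (adj G) u + wdeg r (adj G) v
  inner rewrite wdeg-δ₂ (adj G) u u v | wdeg-δ₂ (adj G) v u v | irr G u | irr G v | sym G v u =
    refl
  heavy : ∀ i → 4 ≤ wdeg w (edge (T i)) u + wdeg w (edge (T i)) v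
  heavy i with st i | edge (T i) u v in uv
  ... | (conn , _) , u∈ , v∈ , c∈ | false
      with neighbour conn u∈ v∈ u≢v | neighbour conn v∈ u∈ (u≢v ∘ ≡-sym)
  ...   | p , p≢u , up | q , q≢v , vq =
    +-mono-≤ (≤-trans (≤-reflexive (≡-sym (w-out p≢u λ { refl → ≡false⇒≢true uv up }))) (wdeg-edge w (edge (T i)) up))
             (≤-trans (≤-reflexive (≡-sym (w-out (λ { refl → ≡false⇒≢true uv (trans (esym (T i) u v) vq) }) q≢v)))
                      (wdeg-edge w (edge (T i)) vq))
  heavy i | (conn , _) , u∈ , v∈ , c∈ | true with crossing pair? (conn u c u∈ c∈) (inj₁ refl) c∉
    where
    pair? : ∀ x → Dec (x ≡ u ⊎ x ≡ v)
    pair? x = x ≟ u ⊎-dec x ≟ v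
    c∉ : ¬ (c ≡ u ⊎ c ≡ v)
    c∉ (inj₁ refl) = u≢c refl
    c∉ (inj₂ refl) = v≢c refl
  ... | p , q , inj₁ refl , q∉ , pq =
    +-mono-≤ (≤-trans (≤-reflexive (≡-sym (cong₂ _+_ w-v (w-out (q∉ ∘ inj₁) (q∉ ∘ inj₂)))))
                      (wdeg-edges w (edge (T i)) (λ { refl → q∉ (inj₂ refl) }) uv pq))
             (≤-trans (≤-reflexive (≡-sym w-u)) (wdeg-edge w (edge (T i)) (trans (esym (T i) v u) uv)))
  ... | p , q , inj₂ refl , q∉ , pq =
    +-mono-≤ (≤-trans (≤-reflexive (≡-sym w-v)) (wdeg-edge w (edge (T i)) uv))
             (≤-trans (≤-reflexive (≡-sym (cong₂ _+_ w-u (w-out (q∉ ∘ inj₁) (q∉ ∘ inj₂)))))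
                      (wdeg-edges w (edge (T i)) (λ { refl → q∉ (inj₁ refl) }) (trans (esym (T i) v u) uv) pq))

-- The weight of a single S-tree

module _ {n : ℕ} {G : Graph n} (T : Subgraph G) (conn : Connected T) (w : Fin n → ℕ) (3≤w : ∀ j → 3 ≤ w j) where

  private
    D : Fin n → ℕ
    D = wdeg w (edge T)

    flip : ∀ {x y b} → edge T x y ≡ b → edge T y x ≡ b
    flip {x} {y} e = trans (esym T y x) e

    3≤D : ∀ {x y} → edge T x y ≡ true → 3 ≤ D x
    3≤D e = ≤-trans (3≤w _) (wdeg-edge w (edge T) e)

    Heavy-outside : Fin n → Fin n → Fin n → Set
    Heavy-outside a b c = ∀ {j} → j ≢ a → j ≢ b → j ≢ c → 4 ≤ w j

    -- The two inner edges alone suffice: 3 + 3 at `a`, and 3 at each of `b` and `c`.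
    two-inner : ∀ {a b c} → b ≢ c → edge T a b ≡ true → edge T a c ≡ true → 12 ≤ D a + D b + D c
    two-inner b≢c ab ac =
      +-mono-≤ (+-mono-≤ (≤-trans (+-mono-≤ (3≤w _) (3≤w _)) (wdeg-edges w (edge T) b≢c ab ac)) (3≤D (flip ab)))
               (3≤D (flip ac))

    no-inner-at : ∀ {a b c} → Heavy-outside a b c → a ≢ b → vert T a ≡ true → vert T b ≡ true →
                  edge T a b ≡ false → edge T a c ≡ false → 4 ≤ D a
    no-inner-at heavy a≢b a∈ b∈ ab ac with neighbour conn a∈ b∈ a≢b
    ... | q , q≢a , aq = ≤-trans (heavy q≢a (λ { refl → ≡false⇒≢true ab aq }) (λ { refl → ≡false⇒≢true ac aq }))
                                 (wdeg-edge w (edge T) aq)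

    -- The inner edge ab gives 3 at both ends. To reach `c` the tree must leave {a, b}, and as ac
    -- and bc are absent that edge ends outside S and weighs 4; so does some edge at `c`. The total
    -- is 14.
    one-inner : ∀ {a b c} → Distinct3 a b c → Heavy-outside a b c →
                vert T a ≡ true → vert T b ≡ true → vert T c ≡ true →
                edge T a b ≡ true → edge T a c ≡ false → edge T b c ≡ false → 12 ≤ D a + D b + D c
    one-inner {a} {b} {c} (a≢b , a≢c , b≢c) heavy a∈ b∈ c∈ ab ac bc
      with crossing (λ x → x ≟ a ⊎-dec x ≟ b) (conn a c a∈ c∈) (inj₁ refl)
                    (λ { (inj₁ c≡a) → a≢c (≡-sym c≡a) ; (inj₂ c≡b) → b≢c (≡-sym c≡b) })
    ... | p , q , inj₁ refl , q∉ , aq =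
      ≤-trans (m≤n+m 12 2) (+-mono-≤ (+-mono-≤ (≤-trans (+-mono-≤ (3≤w _) 4≤wq) (wdeg-edges w (edge T) b≢q ab aq)) (3≤D (flip ab))) 4≤Dc)
      where
      b≢q : b ≢ q
      b≢q refl = q∉ (inj₂ refl)
      4≤wq : 4 ≤ w q
      4≤wq = heavy (q∉ ∘ inj₁) (q∉ ∘ inj₂) (λ { refl → ≡false⇒≢true ac aq })
      4≤Dc : 4 ≤ D c
      4≤Dc = no-inner-at {c} {a} {b} (λ x y z → heavy y z x) (a≢c ∘ ≡-sym) c∈ a∈ (flip ac) (flip bc)
    ... | p , q , inj₂ refl , q∉ , bq =
      ≤-trans (m≤n+m 12 2) (+-mono-≤ (+-mono-≤ (3≤D ab) (≤-trans (+-mono-≤ (3≤w _) 4≤wq) (wdeg-edges w (edge T) a≢q (flip ab) bq))) 4≤Dc)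
      where
      a≢q : a ≢ q
      a≢q refl = q∉ (inj₁ refl)
      4≤wq : 4 ≤ w q
      4≤wq = heavy (q∉ ∘ inj₁) (q∉ ∘ inj₂) (λ { refl → ≡false⇒≢true bc bq })
      4≤Dc : 4 ≤ D c
      4≤Dc = no-inner-at {c} {a} {b} (λ x y z → heavy y z x) (a≢c ∘ ≡-sym) c∈ a∈ (flip ac) (flip bc)

  -- The cases follow the number of tree edges inside S. With two or more, `two-inner` applies at a
  -- common endpoint; with none, each vertex of S has its own edge of weight 4 to the outside.
  tree-load : ∀ {a b c} → Distinct3 a b c → (∀ {j} → j ≢ a → j ≢ b → j ≢ c → 4 ≤ w j) →
              vert T a ≡ true → vert T b ≡ true → vert T c ≡ true → 12 ≤ D a + D b + D c
  tree-load {a} {b} {c} (a≢b , a≢c , b≢c) heavy a∈ b∈ c∈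
    with edge T a b in ab | edge T a c in ac | edge T b c in bc
  ... | true  | true  | _     = two-inner b≢c ab ac
  ... | true  | false | true  = subst (12 ≤_) (swap₁₂ (D b) (D a) (D c)) (two-inner a≢c (flip ab) bc)
    where
    swap₁₂ : ∀ x y z → x + y + z ≡ y + x + z
    swap₁₂ = solve-∀
  ... | false | true  | true  = subst (12 ≤_) (rotate (D c) (D a) (D b)) (two-inner a≢b (flip ac) (flip bc))
    where
    rotate : ∀ x y z → x + y + z ≡ y + z + x
    rotate = solve-∀
  ... | true  | false | false = one-inner (a≢b , a≢c , b≢c) heavy a∈ b∈ c∈ ab ac bc
  ... | false | true  | false = subst (12 ≤_) (swap₂₃ (D a) (D c) (D b))
      (one-inner (a≢c , a≢b , b≢c ∘ ≡-sym) (λ x y z → heavy x z y) a∈ c∈ b∈ ac ab (flip bc))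
    where
    swap₂₃ : ∀ x y z → x + y + z ≡ x + z + y
    swap₂₃ = solve-∀
  ... | false | false | true  = subst (12 ≤_) (rotate′ (D b) (D c) (D a))
      (one-inner (b≢c , a≢b ∘ ≡-sym , a≢c ∘ ≡-sym) (λ x y z → heavy z x y) b∈ c∈ a∈ bc (flip ab) (flip ac))
    where
    rotate′ : ∀ x y z → x + y + z ≡ z + x + y
    rotate′ = solve-∀
  ... | false | false | false =
    +-mono-≤ (+-mono-≤ (no-inner-at heavy a≢b a∈ b∈ ab ac)
                       (no-inner-at (λ x y z → heavy y x z) (a≢b ∘ ≡-sym) b∈ a∈ (flip ab) bc))
             (no-inner-at (λ x y z → heavy y z x) (a≢c ∘ ≡-sym) c∈ a∈ (flip ac) (flip bc))

packing-triple-bound : ∀ {n k} {G : Graph n} {a b c} → HasPacking G a b c k → Distinct3 a b c →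
  k * 12 + 2 * ([ adj G a b ]ᵇ + [ adj G a c ]ᵇ + [ adj G b c ]ᵇ) ≤ 4 * (deg G a + deg G b + deg G c)
packing-triple-bound {n} {k} {G} {a} {b} {c} (T , st , disj) abc@(a≢b , a≢c , b≢c) = begin
  k * 12 + 2 * ([ adj G a b ]ᵇ + [ adj G a c ]ᵇ + [ adj G b c ]ᵇ)
    ≤⟨ +-mono-≤ (load₃ T disj w 12 a b c heavy) (≤-reflexive inner) ⟩
  W a + W b + W c + (R a + R b + R c)
    ≡⟨ interchange (W a) (W b) (W c) (R a) (R b) (R c) ⟩
  (W a + R a) + (W b + R b) + (W c + R c)
    ≡⟨ cong₂ _+_ (cong₂ _+_ (wdeg-complement 4 r (adj G) a r≤4) (wdeg-complement 4 r (adj G) b r≤4))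
                 (wdeg-complement 4 r (adj G) c r≤4) ⟩
  4 * deg G a + 4 * deg G b + 4 * deg G c
    ≡⟨ factor (deg G a) (deg G b) (deg G c) ⟩
  4 * (deg G a + deg G b + deg G c) ∎
  where
  open ≤-Reasoning
  interchange : ∀ p q r x y z → p + q + r + (x + y + z) ≡ (p + x) + (q + y) + (r + z)
  interchange = solve-∀
  factor : ∀ x y z → 4 * x + 4 * y + 4 * z ≡ 4 * (x + y + z)
  factor = solve-∀
  r w W R : Fin n → ℕ
  r j = δ a j + δ b j + δ c j
  w j = 4 ∸ r j
  W = wdeg w (adj G)
  R = wdeg r (adj G)
  r≤1 : ∀ j → r j ≤ 1
  r≤1 j with a ≟ j | b ≟ j | c ≟ j
  ... | yes refl | yes eq   | _       = contradiction (≡-sym eq) a≢b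
  ... | yes refl | no _     | yes eq  = contradiction (≡-sym eq) a≢c
  ... | yes refl | no _     | no _    = ≤-refl
  ... | no _     | yes refl | yes eq  = contradiction (≡-sym eq) b≢c
  ... | no _     | yes refl | no _    = ≤-refl
  ... | no _     | no _     | yes _   = ≤-refl
  ... | no _     | no _     | no _    = z≤n
  r≤4 : ∀ j → r j ≤ 4
  r≤4 j = ≤-trans (r≤1 j) (s≤s z≤n)
  w-out : ∀ {j} → j ≢ a → j ≢ b → j ≢ c → 4 ≤ w j
  w-out j≢a j≢b j≢c rewrite δ-≢ (j≢a ∘ ≡-sym) | δ-≢ (j≢b ∘ ≡-sym) | δ-≢ (j≢c ∘ ≡-sym) = ≤-refl
  heavy : ∀ i → 12 ≤ wdeg w (edge (T i)) a + wdeg w (edge (T i)) b + wdeg w (edge (T i)) c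
  heavy i with st i
  ... | (conn , _) , a∈ , b∈ , c∈ = tree-load (T i) conn w (λ j → ∸-monoʳ-≤ 4 (r≤1 j)) abc w-out a∈ b∈ c∈
  inner : 2 * ([ adj G a b ]ᵇ + [ adj G a c ]ᵇ + [ adj G b c ]ᵇ) ≡ R a + R b + R c
  inner rewrite wdeg-δ₃ (adj G) a a b c | wdeg-δ₃ (adj G) b a b c | wdeg-δ₃ (adj G) c a b c
              | irr G a | irr G b | irr G c | sym G b a | sym G c a | sym G c b =
    collect [ adj G a b ]ᵇ [ adj G a c ]ᵇ [ adj G b c ]ᵇ
    where
    collect : ∀ x y z → 2 * (x + y + z) ≡ (x + y) + (x + 0 + z) + (y + z + 0)
    collect = solve-∀

-- Lower bounds on the number of edges

another : ∀ {n} → 3 ≤ n → (u : Fin n) → ∃ λ v → u ≢ v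
another (s≤s (s≤s _)) u = punchIn u zero , Fin.punchInᵢ≢i u zero ∘ ≡-sym

third : ∀ {n} → 3 ≤ n → {u v : Fin n} → u ≢ v → ∃ λ c → Distinct3 u v c
third (s≤s (s≤s (s≤s _))) {u} {v} u≢v = punchIn u (punchIn v′ zero) , u≢v , Fin.punchInᵢ≢i u _ ∘ ≡-sym ,
  λ v≡c → Fin.punchInᵢ≢i v′ zero (Fin.punchIn-injective u _ _ (≡-sym (trans (Fin.punchIn-punchOut u≢v) v≡c)))
  where v′ = punchOut u≢v

≡ᵇ-cases : ∀ d e → (d ≡ e × [ d ≡ᵇ e ]ᵇ ≡ 1) ⊎ (d ≢ e × [ d ≡ᵇ e ]ᵇ ≡ 0)
≡ᵇ-cases zero    zero    = inj₁ (refl , refl)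
≡ᵇ-cases zero    (suc e) = inj₂ ((λ ()) , refl)
≡ᵇ-cases (suc d) zero    = inj₂ ((λ ()) , refl)
≡ᵇ-cases (suc d) (suc e) with ≡ᵇ-cases d e
... | inj₁ (d≡e , eq) = inj₁ (cong suc d≡e , eq)
... | inj₂ (d≢e , eq) = inj₂ (d≢e ∘ suc-injective , eq)

-- The general bound: independence of the vertices of degree ℓ

module _ {n ℓ : ℕ} (3≤n : 3 ≤ n) (G : Graph n) (pack : ∀ a b c → Distinct3 a b c → HasPacking G a b c ℓ) where

  ℓ≤deg : ∀ v → ℓ ≤ deg G v
  ℓ≤deg v with another 3≤n v
  ... | u , v≢u with third 3≤n v≢u
  ...   | c , vuc = packing≤deg (pack v u c vuc) v≢u

  private
    light : Fin n → ℕ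
    light v = [ deg G v ≡ᵇ ℓ ]ᵇ

    light-deg : ∀ v → light v * deg G v ≡ light v * ℓ
    light-deg v with ≡ᵇ-cases (deg G v) ℓ
    ... | inj₁ (eq , _) = cong (light v *_) eq
    ... | inj₂ (_ , l)  = trans (cong (_* deg G v) l) (≡-sym (cong (_* ℓ) l))

    heavy-deg : ∀ v → ℓ + 1 ≤ deg G v + light v
    heavy-deg v with ≡ᵇ-cases (deg G v) ℓ
    ... | inj₁ (eq , l) = ≤-reflexive (≡-sym (cong₂ _+_ eq l))
    ... | inj₂ (ne , _) = ≤-trans (≤-reflexive (+-comm ℓ 1)) (≤-trans (≤∧≢⇒< (ℓ≤deg v) (ne ∘ ≡-sym)) (m≤m+n _ _))

    -- Two adjacent vertices of degree ℓ would turn `packing-pair-bound` into 4ℓ + 2 ≤ 4ℓ.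
    light-independent : ∀ u v → adj G u v ≡ true → light u + light v ≤ 1
    light-independent u v uv with ≡ᵇ-cases (deg G u) ℓ | ≡ᵇ-cases (deg G v) ℓ
    ... | inj₂ (_ , l)  | _              = ≤-trans (≤-reflexive (cong (_+ light v) l)) ([]ᵇ≤1 _)
    ... | inj₁ _        | inj₂ (_ , l)   = ≤-trans (≤-reflexive (trans (cong (light u +_) l) (+-identityʳ _))) ([]ᵇ≤1 _)
    ... | inj₁ (eq , _) | inj₁ (eq′ , _) = contradiction too-many (<-irrefl refl)
      where
      u≢v : u ≢ v
      u≢v refl = contradiction (trans (≡-sym (irr G u)) uv) λ ()
      double : ∀ x → 2 * (x + x) ≡ x * 4
      double = solve-∀
      bound₂ = packing-pair-bound (pack u v (proj₁ (third 3≤n u≢v)) (proj₂ (third 3≤n u≢v))) (proj₂ (third 3≤n u≢v))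
      too-many : ℓ * 4 < ℓ * 4
      too-many = begin-strict
        ℓ * 4                         <⟨ m<m+n (ℓ * 4) (s≤s z≤n) ⟩
        ℓ * 4 + 2                     ≡⟨ cong (λ b → ℓ * 4 + 2 * [ b ]ᵇ) uv ⟨
        ℓ * 4 + 2 * [ adj G u v ]ᵇ    ≤⟨ bound₂ ⟩
        2 * (deg G u + deg G v)       ≡⟨ cong₂ (λ x y → 2 * (x + y)) eq eq′ ⟩
        2 * (ℓ + ℓ)                   ≡⟨ double ℓ ⟩
        ℓ * 4                         ∎
        where open ≤-Reasoning

    |light| : ℕ
    |light| = sum light

    -- Each light vertex has ℓ edges, and no edge is counted at both ends. The count runs over
    -- ordered pairs, hence the factor 2.
    light-edges : ℓ * |light| ≤ edgeCount G
    light-edges = *-cancelˡ-≤ 2 (begin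
      2 * (ℓ * |light|)
        ≡⟨ cong (2 *_) (trans (*-distribˡ-sum ℓ light) (sum-cong-≗ λ v → trans (*-comm ℓ (light v)) (≡-sym (light-deg v)))) ⟩
      2 * L
        ≡⟨ cong (L +_) (+-identityʳ L) ⟩
      L + L
        ≡⟨ cong₂ _+_ (sum-cong-≗ λ u → *-distribˡ-sum (light u) (λ v → [ adj G u v ]ᵇ))
             (trans (sum-cong-≗ λ v → trans (*-distribˡ-sum (light v) (λ u → [ adj G v u ]ᵇ)) (sum-cong-≗ λ u → cong (λ b → light v * [ b ]ᵇ) (sym G v u)))
                    (∑-comm λ v u → light v * [ adj G u v ]ᵇ)) ⟩
      sum (λ u → sum λ v → light u * [ adj G u v ]ᵇ) + sum (λ u → sum λ v → light v * [ adj G u v ]ᵇ)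
        ≡⟨ ∑-distrib-+ (λ u → sum λ v → light u * [ adj G u v ]ᵇ) _ ⟨
      sum (λ u → sum (λ v → light u * [ adj G u v ]ᵇ) + sum (λ v → light v * [ adj G u v ]ᵇ))
        ≡⟨ sum-cong-≗ (λ u → ∑-distrib-+ (λ v → light u * [ adj G u v ]ᵇ) (λ v → light v * [ adj G u v ]ᵇ)) ⟨
      sum (λ u → sum λ v → light u * [ adj G u v ]ᵇ + light v * [ adj G u v ]ᵇ)
        ≤⟨ sum-mono-≤ (λ u → sum-mono-≤ (pointwise u)) ⟩
      sum (deg G)
        ≡⟨ handshake G ⟩
      2 * edgeCount G ∎)
      where
      open ≤-Reasoning
      L = sum λ v → light v * deg G v
      pointwise : ∀ u v → light u * [ adj G u v ]ᵇ + light v * [ adj G u v ]ᵇ ≤ [ adj G u v ]ᵇ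
      pointwise u v with adj G u v in uv
      ... | false rewrite *-zeroʳ (light u) | *-zeroʳ (light v) = z≤n
      ... | true  rewrite *-identityʳ (light u) | *-identityʳ (light v) = light-independent u v uv

    -- All degrees are at least ℓ, and a light vertex falls short of ℓ + 1 by exactly the one that
    -- its indicator adds back.
    degree-sum : n * (ℓ + 1) ≤ 2 * edgeCount G + |light|
    degree-sum = begin
      n * (ℓ + 1)                         ≡⟨ sum-const n (ℓ + 1) ⟨
      sum {n} (λ _ → ℓ + 1)               ≤⟨ sum-mono-≤ heavy-deg ⟩
      sum (λ v → deg G v + light v)       ≡⟨ ∑-distrib-+ (deg G) light ⟩
      sum (deg G) + |light|               ≡⟨ cong (_+ |light|) (handshake G) ⟩
      2 * edgeCount G + |light|           ∎
      where open ≤-Reasoning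

  -- Vertices of degree ℓ are pairwise non-adjacent, which bounds their number by |E| / ℓ.
  bound≤edgeCount : bound n ℓ ≤ edgeCount G
  bound≤edgeCount = ≤-pred (m<n*o⇒m/o<n {n = suc (edgeCount G)} (begin-strict
    ℓ * (ℓ + 1) * n + ℓ + ℓ                       ≡⟨ regroup ℓ n ⟩
    ℓ * (n * (ℓ + 1)) + (ℓ + ℓ)                   ≤⟨ +-monoˡ-≤ (ℓ + ℓ) (*-monoʳ-≤ ℓ degree-sum) ⟩
    ℓ * (2 * e + |light|) + (ℓ + ℓ)               ≡⟨ expand ℓ e |light| ⟩
    ℓ * |light| + (ℓ * (2 * e) + (ℓ + ℓ))         ≤⟨ +-monoˡ-≤ _ light-edges ⟩
    -- The 2ℓ in the numerator of `bound` is the rounding term of the ceiling; being one less than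
    -- the divisor 2ℓ + 1, it keeps the numerator just below (e + 1)(2ℓ + 1).
    e + (ℓ * (2 * e) + (ℓ + ℓ))                   <⟨ n<1+n _ ⟩
    suc (e + (ℓ * (2 * e) + (ℓ + ℓ)))             ≡⟨ collect ℓ e ⟩
    suc e * suc (ℓ + ℓ)                           ∎))
    where
    open ≤-Reasoning
    e = edgeCount G
    regroup : ∀ ℓ n → ℓ * (ℓ + 1) * n + ℓ + ℓ ≡ ℓ * (n * (ℓ + 1)) + (ℓ + ℓ)
    regroup = solve-∀
    expand : ∀ ℓ e x → ℓ * (2 * e + x) + (ℓ + ℓ) ≡ ℓ * x + (ℓ * (2 * e) + (ℓ + ℓ))
    expand = solve-∀
    collect : ∀ ℓ e → suc (e + (ℓ * (2 * e) + (ℓ + ℓ))) ≡ suc e * suc (ℓ + ℓ)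
    collect = solve-∀

-- Degrees in the complement

nonadj : ∀ {n} → Graph n → Fin n → Fin n → Bool
nonadj G u v = not (adj G u v) ∧ not (does (u ≟ v))

codeg : ∀ {n} → Graph n → Fin n → ℕ
codeg G v = sum λ j → [ nonadj G v j ]ᵇ

adj+nonadj : ∀ {n} (G : Graph n) {u v} → u ≢ v → [ adj G u v ]ᵇ + [ nonadj G u v ]ᵇ ≡ 1
adj+nonadj G {u} {v} u≢v with adj G u v | u ≟ v
... | _     | yes u≡v = contradiction u≡v u≢v
... | true  | no _ = refl
... | false | no _ = refl

nonadj-sym : ∀ {n} (G : Graph n) u v → nonadj G u v ≡ nonadj G v u
nonadj-sym G u v rewrite sym G u v with u ≟ v | v ≟ u
... | yes _   | yes _   = refl
... | no  _   | no  _   = refl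
... | yes u≡v | no  v≢u = contradiction (≡-sym u≡v) v≢u
... | no  u≢v | yes v≡u = contradiction (≡-sym v≡u) u≢v

deg+codeg : ∀ {n} (G : Graph n) v → deg G v + codeg G v + 1 ≡ n
deg+codeg {n} G v = begin
  deg G v + codeg G v + 1                                     ≡⟨ cong (deg G v + codeg G v +_) (sum-δ v) ⟨
  deg G v + codeg G v + sum (δ v)                             ≡⟨ ∑-distrib-+₃ (λ j → [ adj G v j ]ᵇ) _ (δ v) ⟨
  sum (λ j → [ adj G v j ]ᵇ + [ nonadj G v j ]ᵇ + δ v j)      ≡⟨ sum-cong-≗ pointwise ⟩
  sum {n} (λ _ → 1)                                           ≡⟨ trans (sum-const n 1) (*-identityʳ n) ⟩
  n                                                           ∎
  where
  open ≡-Reasoning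
  pointwise : ∀ j → [ adj G v j ]ᵇ + [ nonadj G v j ]ᵇ + δ v j ≡ 1
  pointwise j with v ≟ j
  ... | yes refl rewrite irr G v = refl
  ... | no  v≢j with adj G v j
  ...   | true  = refl
  ...   | false = refl

2*nC2+n≡n*n : ∀ n → 2 * (n C 2) + n ≡ n * n
2*nC2+n≡n*n zero    = refl
2*nC2+n≡n*n (suc n) = begin
  2 * (suc n C 2) + suc n          ≡⟨ cong (λ x → 2 * x + suc n) (nCk+nC[k+1]≡[n+1]C[k+1] n 1) ⟨
  2 * (n C 1 + n C 2) + suc n      ≡⟨ cong (λ x → 2 * (x + n C 2) + suc n) (nC1≡n n) ⟩
  2 * (n + n C 2) + suc n          ≡⟨ regroup n (n C 2) ⟩
  2 * (n C 2) + n + (n + suc n)    ≡⟨ cong (_+ (n + suc n)) (2*nC2+n≡n*n n) ⟩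
  n * n + (n + suc n)              ≡⟨ square n ⟩
  suc n * suc n                    ∎
  where
  open ≡-Reasoning
  regroup : ∀ n c → 2 * (n + c) + suc n ≡ 2 * c + n + (n + suc n)
  regroup = solve-∀
  square : ∀ n → n * n + (n + suc n) ≡ suc n * suc n
  square = solve-∀

edgeCount+codegs : ∀ {n} (G : Graph n) → 2 * edgeCount G + sum (codeg G) ≡ 2 * (n C 2)
edgeCount+codegs {n} G = +-cancelʳ-≡ n _ _ (begin
  2 * edgeCount G + sum (codeg G) + n           ≡⟨ cong₂ (λ x y → x + sum (codeg G) + y) (handshake G) (trans (sum-const n 1) (*-identityʳ n)) ⟨
  sum (deg G) + sum (codeg G) + sum {n} (λ _ → 1) ≡⟨ ∑-distrib-+₃ (deg G) (codeg G) (λ _ → 1) ⟨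
  sum (λ v → deg G v + codeg G v + 1)           ≡⟨ sum-cong-≗ (deg+codeg G) ⟩
  sum {n} (λ _ → n)                             ≡⟨ sum-const n n ⟩
  n * n                                         ≡⟨ 2*nC2+n≡n*n n ⟨
  2 * (n C 2) + n                               ∎)
  where open ≡-Reasoning

-- `packing-triple-bound` read in the complement. Replacing each degree by n - 1 - codegree gives 12
-- of the constant 18; replacing e(S) by 3 minus the number of non-adjacent pairs gives the other 6.
packing-codeg-bound : ∀ {n k} {G : Graph n} {a b c} → HasPacking G a b c k → Distinct3 a b c →
  k * 12 + 18 + 4 * (codeg G a + codeg G b + codeg G c) ≤
  12 * n + 2 * ([ nonadj G a b ]ᵇ + [ nonadj G a c ]ᵇ + [ nonadj G b c ]ᵇ)
packing-codeg-bound {n} {k} {G} {a} {b} {c} p abc@(a≢b , a≢c , b≢c) = begin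
  k * 12 + 18 + 4 * H
    ≡⟨ cong (λ x → k * 12 + (2 * x + 12) + 4 * H) three ⟨
  k * 12 + (2 * (x + x̄ + (y + ȳ) + (z + z̄)) + 12) + 4 * H
    ≡⟨ regroup₁ (k * 12) x x̄ y ȳ z z̄ H ⟩
  k * 12 + 2 * (x + y + z) + (2 * (x̄ + ȳ + z̄) + 12 + 4 * H)
    ≤⟨ +-monoˡ-≤ _ (packing-triple-bound p abc) ⟩
  4 * (deg G a + deg G b + deg G c) + (2 * (x̄ + ȳ + z̄) + 12 + 4 * H)
    ≡⟨ regroup₂ (deg G a) (deg G b) (deg G c) (codeg G a) (codeg G b) (codeg G c) (2 * (x̄ + ȳ + z̄)) ⟩
  4 * ((deg G a + codeg G a + 1) + (deg G b + codeg G b + 1) + (deg G c + codeg G c + 1)) + 2 * (x̄ + ȳ + z̄)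
    ≡⟨ cong (λ s → 4 * s + 2 * (x̄ + ȳ + z̄)) (cong₂ _+_ (cong₂ _+_ (deg+codeg G a) (deg+codeg G b)) (deg+codeg G c)) ⟩
  4 * (n + n + n) + 2 * (x̄ + ȳ + z̄)
    ≡⟨ cong (_+ 2 * (x̄ + ȳ + z̄)) (twelve n) ⟩
  12 * n + 2 * (x̄ + ȳ + z̄) ∎
  where
  open ≤-Reasoning
  H = codeg G a + codeg G b + codeg G c
  x = [ adj G a b ]ᵇ
  y = [ adj G a c ]ᵇ
  z = [ adj G b c ]ᵇ
  x̄ = [ nonadj G a b ]ᵇ
  ȳ = [ nonadj G a c ]ᵇ
  z̄ = [ nonadj G b c ]ᵇ
  three : x + x̄ + (y + ȳ) + (z + z̄) ≡ 3
  three = cong₂ _+_ (cong₂ _+_ (adj+nonadj G a≢b) (adj+nonadj G a≢c)) (adj+nonadj G b≢c)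
  regroup₁ : ∀ k x x̄ y ȳ z z̄ h → k + (2 * (x + x̄ + (y + ȳ) + (z + z̄)) + 12) + 4 * h ≡ k + 2 * (x + y + z) + (2 * (x̄ + ȳ + z̄) + 12 + 4 * h)
  regroup₁ = solve-∀
  regroup₂ : ∀ a b c x y z s → 4 * (a + b + c) + (s + 12 + 4 * (x + y + z)) ≡ 4 * ((a + x + 1) + (b + y + 1) + (c + z + 1)) + s
  regroup₂ = solve-∀
  twelve : ∀ n → 4 * (n + n + n) ≡ 12 * n
  twelve = solve-∀

maximiser : ∀ {n} (f : Fin n → ℕ) {P : Fin n → Set} → (∀ v → Dec (P v)) → ∃ P → ∃ λ a → P a × (∀ v → P v → f v ≤ f a)
maximiser {n} f {P} P? (x , px) =
  argmax f x xs , argmax-all f px (all-filter P? (allFin n)) ,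
  λ v pv → All.lookup (f[xs]≤f[argmax] x xs) (∈-filter⁺ P? (∈-allFin v) pv)
  where xs = filter P? (allFin n)

record TopThree {n} (f : Fin n → ℕ) : Set where
  field
    {a b c}  : Fin n
    distinct : Distinct3 a b c
    below    : ∀ v → v ≢ a → v ≢ b → v ≢ c → f v ≤ f a × f v ≤ f b × f v ≤ f c

topThree : ∀ {n} → 3 ≤ n → (f : Fin n → ℕ) → TopThree f
topThree 3≤n@(s≤s _) f with maximiser f {λ _ → ⊤} (λ _ → yes tt) (zero , tt)
... | a , _ , max-a with maximiser f {λ v → a ≢ v} (λ v → ¬? (a ≟ v)) (another 3≤n a)
...   | b , a≢b , max-b with maximiser f {λ v → a ≢ v × b ≢ v} (λ v → ¬? (a ≟ v) ×-dec ¬? (b ≟ v))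
                               (let (c , _ , a≢c , b≢c) = third 3≤n a≢b in c , a≢c , b≢c)
...     | c , (a≢c , b≢c) , max-c = record
  { distinct = a≢b , a≢c , b≢c
  ; below    = λ v v≢a v≢b v≢c → max-a v tt , max-b v (v≢a ∘ ≡-sym) , max-c v (v≢a ∘ ≡-sym , v≢b ∘ ≡-sym)
  }

-- The term 3r is moved to the left to avoid the truncated subtraction in (n - 3)r + f a + f b + f
-- c.
sum≤three : ∀ {n} (f : Fin n → ℕ) r {a b c} → Distinct3 a b c → (∀ v → v ≢ a → v ≢ b → v ≢ c → f v ≤ r) →
            sum f + 3 * r ≤ n * r + (f a + f b + f c)
sum≤three {n} f r {a} {b} {c} (a≢b , a≢c , b≢c) rest≤r = begin
  sum f + 3 * r
    ≡⟨ cong (sum f +_) (cong₂ _+_ (≡-sym (sum-δ-* a (λ _ → r))) (cong₂ _+_ (≡-sym (sum-δ-* b (λ _ → r))) (trans (+-identityʳ r) (≡-sym (sum-δ-* c (λ _ → r)))))) ⟩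
  sum f + (sum (λ v → δ a v * r) + (sum (λ v → δ b v * r) + sum (λ v → δ c v * r)))
    ≡⟨ cong (sum f +_) (cong (sum (λ v → δ a v * r) +_) (∑-distrib-+ (λ v → δ b v * r) (λ v → δ c v * r))) ⟨
  sum f + (sum (λ v → δ a v * r) + sum (λ v → δ b v * r + δ c v * r))
    ≡⟨ cong (sum f +_) (∑-distrib-+ (λ v → δ a v * r) (λ v → δ b v * r + δ c v * r)) ⟨
  sum f + sum (λ v → δ a v * r + (δ b v * r + δ c v * r))
    ≡⟨ ∑-distrib-+ f (λ v → δ a v * r + (δ b v * r + δ c v * r)) ⟨
  sum (λ v → f v + (δ a v * r + (δ b v * r + δ c v * r)))
    ≤⟨ sum-mono-≤ pointwise ⟩
  sum (λ v → r + (δ a v * f v + δ b v * f v + δ c v * f v))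
    ≡⟨ ∑-distrib-+ (λ _ → r) (λ v → δ a v * f v + δ b v * f v + δ c v * f v) ⟩
  sum {n} (λ _ → r) + sum (λ v → δ a v * f v + δ b v * f v + δ c v * f v)
    ≡⟨ cong₂ _+_ (sum-const n r) (∑-distrib-+₃ (λ v → δ a v * f v) (λ v → δ b v * f v) (λ v → δ c v * f v)) ⟩
  n * r + (sum (λ v → δ a v * f v) + sum (λ v → δ b v * f v) + sum (λ v → δ c v * f v))
    ≡⟨ cong (n * r +_) (cong₂ _+_ (cong₂ _+_ (sum-δ-* a f) (sum-δ-* b f)) (sum-δ-* c f)) ⟩
  n * r + (f a + f b + f c) ∎
  where
  open ≤-Reasoning
  pointwise : ∀ v → f v + (δ a v * r + (δ b v * r + δ c v * r)) ≤ r + (δ a v * f v + δ b v * f v + δ c v * f v)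
  pointwise v with a ≟ v | b ≟ v | c ≟ v
  ... | yes refl | yes eq   | _        = contradiction (≡-sym eq) a≢b
  ... | yes refl | no _     | yes eq   = contradiction (≡-sym eq) a≢c
  ... | no _     | yes refl | yes eq   = contradiction (≡-sym eq) b≢c
  ... | yes refl | no _     | no _     = ≤-reflexive (at-a r (f a))
    where
    at-a : ∀ r x → x + (1 * r + (0 + 0)) ≡ r + (1 * x + 0 + 0)
    at-a = solve-∀
  ... | no _     | yes refl | no _     = ≤-reflexive (at-b r (f b))
    where
    at-b : ∀ r x → x + (0 + (1 * r + 0)) ≡ r + (0 + 1 * x + 0)
    at-b = solve-∀
  ... | no _     | no _     | yes refl = ≤-reflexive (at-c r (f c))
    where
    at-c : ∀ r x → x + (0 + (0 + 1 * r)) ≡ r + (0 + 0 + 1 * x)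
    at-c = solve-∀
  ... | no a≢v   | no b≢v   | no c≢v   =
    subst₂ _≤_ (≡-sym (+-identityʳ (f v))) (≡-sym (+-identityʳ r)) (rest≤r v (a≢v ∘ ≡-sym) (b≢v ∘ ≡-sym) (c≢v ∘ ≡-sym))

all-true : ∀ p q r → 3 ≤ [ p ]ᵇ + [ q ]ᵇ + [ r ]ᵇ → p ≡ true × q ≡ true × r ≡ true
all-true true  true  true  _ = refl , refl , refl
all-true false q     r     h = contradiction (≤-trans h (+-mono-≤ ([]ᵇ≤1 q) ([]ᵇ≤1 r))) (<⇒≱ (n<1+n 2))
all-true true  false r     h = contradiction (≤-trans h (s≤s ([]ᵇ≤1 r))) (<⇒≱ (n<1+n 2))
all-true true  true  false h = contradiction h (<⇒≱ (n<1+n 2))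

three-bits≤3 : ∀ p q r → [ p ]ᵇ + [ q ]ᵇ + [ r ]ᵇ ≤ 3
three-bits≤3 p q r = +-mono-≤ (+-mono-≤ ([]ᵇ≤1 p) ([]ᵇ≤1 q)) ([]ᵇ≤1 r)

codeg≥2 : ∀ {n} (G : Graph n) {v i j} → i ≢ j → nonadj G v i ≡ true → nonadj G v j ≡ true → 2 ≤ codeg G v
codeg≥2 G {v} i≢j ni nj = ≤-trans (≤-reflexive (≡-sym (cong₂ (λ x y → [ x ]ᵇ + [ y ]ᵇ) ni nj)))
                                  (two-terms≤sum (λ j → [ nonadj G v j ]ᵇ) i≢j)

codeg≥3 : ∀ {n} (G : Graph n) {v i j k} → Distinct3 i j k →
          nonadj G v i ≡ true → nonadj G v j ≡ true → nonadj G v k ≡ true → 3 ≤ codeg G v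
codeg≥3 G {v} {i} {j} {k} (i≢j , i≢k , j≢k) ni nj nk = begin
  3                                          ≡⟨ cong₂ _+_ (cong₂ _+_ (sum-δ i) (sum-δ j)) (sum-δ k) ⟨
  sum (δ i) + sum (δ j) + sum (δ k)          ≡⟨ ∑-distrib-+₃ (δ i) (δ j) (δ k) ⟨
  sum (λ x → δ i x + δ j x + δ k x)          ≤⟨ sum-mono-≤ pointwise ⟩
  codeg G v                                  ∎
  where
  open ≤-Reasoning
  pointwise : ∀ x → δ i x + δ j x + δ k x ≤ [ nonadj G v x ]ᵇ
  pointwise x with i ≟ x | j ≟ x | k ≟ x
  ... | yes refl | yes eq   | _        = contradiction (≡-sym eq) i≢j
  ... | yes refl | no _     | yes eq   = contradiction (≡-sym eq) i≢k
  ... | no _     | yes refl | yes eq   = contradiction (≡-sym eq) j≢k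
  ... | yes refl | no _     | no _     rewrite ni = ≤-refl
  ... | no _     | yes refl | no _     rewrite nj = ≤-refl
  ... | no _     | no _     | yes refl rewrite nk = ≤-refl
  ... | no _     | no _     | no _     = z≤n

-- The codegree sum when every triple has n - 2 disjoint trees

module _ {n m : ℕ} (n≡3+m : n ≡ 3 + m) (G : Graph n) (pack : ∀ a b c → Distinct3 a b c → HasPacking G a b c (1 + m)) where

  private
    f : Fin n → ℕ
    f = codeg G

    N : Fin n → Fin n → ℕ
    N u v = [ nonadj G u v ]ᵇ

    4*triple : ∀ {a b c} → Distinct3 a b c → 4 * (f a + f b + f c) ≤ 6 + 2 * (N a b + N a c + N b c)
    -- For k = 1 + m the left constant is 12(1 + m) + 18, against 12(3 + m) on the right; the
    -- difference is 6.
    4*triple {a} {b} {c} abc = +-cancelˡ-≤ (30 + 12 * m) (4 * (f a + f b + f c)) (6 + 2 * (N a b + N a c + N b c))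
      (subst₂ _≤_ (lhs m (f a + f b + f c)) (rhs (N a b + N a c + N b c)) (packing-codeg-bound (pack a b c abc) abc))
      where
      lhs : ∀ m h → (1 + m) * 12 + 18 + 4 * h ≡ 30 + 12 * m + 4 * h
      lhs = solve-∀
      rhs : ∀ x → 12 * n + 2 * x ≡ 30 + 12 * m + (6 + 2 * x)
      rhs x = trans (cong (λ n → 12 * n + 2 * x) n≡3+m) (eval m x)
        where
        eval : ∀ m x → 12 * (3 + m) + 2 * x ≡ 30 + 12 * m + (6 + 2 * x)
        eval = solve-∀

    triple≤3 : ∀ {a b c} → Distinct3 a b c → f a + f b + f c ≤ 3
    triple≤3 {a} {b} {c} abc = *-cancelˡ-≤ {f a + f b + f c} {3} 4 (≤-trans (4*triple abc)
      (+-monoʳ-≤ 6 (*-monoʳ-≤ 2 (three-bits≤3 (nonadj G a b) (nonadj G a c) (nonadj G b c)))))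

    -- A sum of 3 would need all three pairs non-adjacent, since 12 ≤ 6 + 2·3 is tight. But then `a`
    -- and `b` each have two non-neighbours within the triple, which already gives 4.
    triple≤2 : ∀ {a b c} → Distinct3 a b c → f a + f b + f c ≤ 2
    triple≤2 {a} {b} {c} abc@(a≢b , a≢c , b≢c) = ≮⇒≥ λ 3≤f →
      let (ab , ac , bc) = all-true (nonadj G a b) (nonadj G a c) (nonadj G b c)
            (*-cancelˡ-≤ {3} {N a b + N a c + N b c} 2 (+-cancelˡ-≤ 6 6 _ (≤-trans (*-monoʳ-≤ 4 3≤f) (4*triple abc))))
          4≤f = ≤-trans (+-mono-≤ (codeg≥2 G b≢c ab ac) (codeg≥2 G a≢c (trans (nonadj-sym G b a) ab) bc)) (m≤m+n (f a + f b) (f c))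
      in contradiction (≤-trans 4≤f (triple≤3 abc)) (<⇒≱ (n<1+n 3))

  -- A positive codegree outside the three largest would make those three positive as well, with sum
  -- at least 3. So the three largest carry the whole sum.
  ∑codeg≤2 : sum (codeg G) ≤ 2
  ∑codeg≤2 = begin
    sum f                        ≡⟨ +-identityʳ (sum f) ⟨
    sum f + 3 * 0                ≤⟨ sum≤three f 0 distinct (λ v v≢a v≢b v≢c → ≮⇒≥ (small v (below v v≢a v≢b v≢c))) ⟩
    n * 0 + (f a + f b + f c) ≡⟨ cong (_+ (f a + f b + f c)) (*-zeroʳ n) ⟩
    f a + f b + f c              ≤⟨ triple≤2 distinct ⟩
    2                            ∎
    where
    open ≤-Reasoning
    open TopThree (topThree (subst (3 ≤_) (≡-sym n≡3+m) (m≤m+n 3 m)) f)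
    small : ∀ v → f v ≤ f a × f v ≤ f b × f v ≤ f c → ¬ (1 ≤ f v)
    small v (va , vb , vc) 1≤fv = contradiction
      (≤-trans (+-mono-≤ (+-mono-≤ (≤-trans 1≤fv va) (≤-trans 1≤fv vb)) (≤-trans 1≤fv vc)) (triple≤2 distinct)) (<⇒≱ (n<1+n 2))

-- The codegree sum when every triple has n - 3 disjoint trees

module _ {n m : ℕ} (n≡3+m : n ≡ 3 + m) (G : Graph n) (pack : ∀ a b c → Distinct3 a b c → HasPacking G a b c m) where

  private
    f : Fin n → ℕ
    f = codeg G

    N : Fin n → Fin n → ℕ
    N u v = [ nonadj G u v ]ᵇ

    4*triple : ∀ {a b c} → Distinct3 a b c → 4 * (f a + f b + f c) ≤ 18 + 2 * (N a b + N a c + N b c)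
    4*triple {a} {b} {c} abc = +-cancelˡ-≤ (18 + 12 * m) (4 * (f a + f b + f c)) (18 + 2 * (N a b + N a c + N b c))
      (subst₂ _≤_ (lhs m (f a + f b + f c)) (rhs (N a b + N a c + N b c)) (packing-codeg-bound (pack a b c abc) abc))
      where
      lhs : ∀ m h → m * 12 + 18 + 4 * h ≡ 18 + 12 * m + 4 * h
      lhs = solve-∀
      rhs : ∀ x → 12 * n + 2 * x ≡ 18 + 12 * m + (18 + 2 * x)
      rhs x = trans (cong (λ n → 12 * n + 2 * x) n≡3+m) (eval m x)
        where
        eval : ∀ m x → 12 * (3 + m) + 2 * x ≡ 18 + 12 * m + (18 + 2 * x)
        eval = solve-∀

    triple≤6 : ∀ {a b c} → Distinct3 a b c → f a + f b + f c ≤ 6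
    triple≤6 {a} {b} {c} abc = *-cancelˡ-≤ {f a + f b + f c} {6} 4 (≤-trans (4*triple abc)
      (+-monoʳ-≤ 18 (*-monoʳ-≤ 2 (three-bits≤3 (nonadj G a b) (nonadj G a c) (nonadj G b c)))))

    -- Here the three codegrees reach the maximum 6, and 24 ≤ 18 + 2·3 leaves no room for an
    -- adjacent pair.
    independent : ∀ {a b c} → Distinct3 a b c → 2 ≤ f a → 2 ≤ f b → 2 ≤ f c →
                  nonadj G a b ≡ true × nonadj G a c ≡ true × nonadj G b c ≡ true
    independent {a} {b} {c} abc fa fb fc = all-true (nonadj G a b) (nonadj G a c) (nonadj G b c)
      (*-cancelˡ-≤ {3} {N a b + N a c + N b c} 2 (+-cancelˡ-≤ 18 6 _ (≤-trans (*-monoʳ-≤ 4 (+-mono-≤ (+-mono-≤ fa fb) fc)) (4*triple abc))))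

    -- Four vertices of codegree at least 2 would be pairwise non-adjacent, so of codegree at least 3.
    no-four : ∀ {a b c v} → Distinct3 a b c → v ≢ a → v ≢ b → v ≢ c → ¬ (2 ≤ f a × 2 ≤ f b × 2 ≤ f c × 2 ≤ f v)
    no-four {a} {b} {c} {v} abc@(a≢b , a≢c , b≢c) v≢a v≢b v≢c (fa , fb , fc , fv) = <⇒≱ {6} {7} (n<1+n 6)
      (≤-trans (+-mono-≤ (+-mono-≤ (codeg≥3 G (b≢c , v≢b ∘ ≡-sym , v≢c ∘ ≡-sym) ab ac av) fb) fc) (triple≤6 abc))
      where
      ab : nonadj G a b ≡ true
      ab = proj₁ (independent abc fa fb fc)
      ac : nonadj G a c ≡ true
      ac = proj₁ (proj₂ (independent abc fa fb fc))
      av : nonadj G a v ≡ true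
      av = proj₁ (proj₂ (independent (a≢b , v≢a ∘ ≡-sym , v≢b ∘ ≡-sym) fa fb fv))

  -- By `no-four` only the three largest codegrees can exceed 1, and they add up to at most 6,
  -- whence (n - 3) + 6.
  ∑codeg≤n+3 : sum (codeg G) ≤ n + 3
  ∑codeg≤n+3 = +-cancelʳ-≤ 3 (sum f) (n + 3) (begin
    sum f + 3                       ≤⟨ sum≤three f 1 distinct (λ v v≢a v≢b v≢c → ≮⇒≥ (small v v≢a v≢b v≢c (below v v≢a v≢b v≢c))) ⟩
    n * 1 + (f a + f b + f c) ≤⟨ +-mono-≤ (≤-reflexive (*-identityʳ n)) (triple≤6 distinct) ⟩
    n + 6                           ≡⟨ +-assoc n 3 3 ⟨
    n + 3 + 3                       ∎)
    where
    open ≤-Reasoning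
    open TopThree (topThree (subst (3 ≤_) (≡-sym n≡3+m) (m≤m+n 3 m)) f)
    small : ∀ v → v ≢ a → v ≢ b → v ≢ c → f v ≤ f a × f v ≤ f b × f v ≤ f c → ¬ (2 ≤ f v)
    small v v≢a v≢b v≢c (va , vb , vc) 2≤fv =
      no-four distinct v≢a v≢b v≢c (≤-trans 2≤fv va , ≤-trans 2≤fv vb , ≤-trans 2≤fv vc , 2≤fv)

-- The codegree sum is twice the number of non-edges, hence even, so the odd bound 2q + 1 still
-- allows only q non-edges. This absorbs the remainder of n + 3 modulo 2.
∑codeg≤2*q⇒nC2∸q≤edgeCount : ∀ {n} (G : Graph n) q → sum (codeg G) ≤ suc (q * 2) → n C 2 ∸ q ≤ edgeCount G
∑codeg≤2*q⇒nC2∸q≤edgeCount {n} G q h = m≤n+o⇒m∸n≤o (n C 2) q (≤-pred (*-cancelˡ-< 2 _ _ (begin-strict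
  2 * (n C 2)                      ≡⟨ edgeCount+codegs G ⟨
  2 * edgeCount G + sum (codeg G)  ≤⟨ +-monoʳ-≤ (2 * edgeCount G) h ⟩
  2 * edgeCount G + suc (q * 2)    <⟨ n<1+n _ ⟩
  suc (2 * edgeCount G + suc (q * 2)) ≡⟨ regroup (edgeCount G) q ⟩
  2 * suc (q + edgeCount G)        ∎)))
  where
  open ≤-Reasoning
  regroup : ∀ e q → suc (2 * e + suc (q * 2)) ≡ 2 * suc (q + e)
  regroup = solve-∀

-- By the same parity, a codegree sum of 2q - 1 already forces q non-edges, so it is enough to bound
-- the sum from below up to one.
∑codeg≥2*q∸1⇒edgeCount≤nC2∸q : ∀ {n} (G : Graph n) q → q * 2 ≤ suc (sum (codeg G)) → edgeCount G ≤ n C 2 ∸ q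
∑codeg≥2*q∸1⇒edgeCount≤nC2∸q {n} G q h = m+n≤o⇒m≤o∸n (edgeCount G) (≤-pred (*-cancelˡ-< 2 _ _ (begin-strict
  2 * (edgeCount G + q)                  ≡⟨ regroup (edgeCount G) q ⟩
  2 * edgeCount G + q * 2                ≤⟨ +-monoʳ-≤ (2 * edgeCount G) h ⟩
  2 * edgeCount G + suc (sum (codeg G))  ≡⟨ +-suc (2 * edgeCount G) _ ⟩
  suc (2 * edgeCount G + sum (codeg G))  ≡⟨ cong suc (edgeCount+codegs G) ⟩
  suc (2 * (n C 2))                      <⟨ n<1+n _ ⟩
  2 + 2 * (n C 2)                        ≡⟨ *-distribˡ-+ 2 1 (n C 2) ⟨
  2 * suc (n C 2)                        ∎)))
  where
  open ≤-Reasoning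
  regroup : ∀ e q → 2 * (e + q) ≡ 2 * e + q * 2
  regroup = solve-∀

-- Packings in complete multipartite graphs

steps : ∀ {A : Set} → List A → List (A × A)
steps []           = []
steps (x ∷ [])     = []
steps (x ∷ y ∷ zs) = (x , y) ∷ steps (y ∷ zs)

EdgeDisjoint : ∀ {A : Set} → List A → List A → Set
EdgeDisjoint ws ws′ = All (λ (x , y) → (x , y) ∉ steps ws′ × (y , x) ∉ steps ws′) (steps ws)

-- A connected subgraph covering a, b and c is given by any walk through its edges; edges may be repeated.
IsWalkPacking : ∀ {A I : Set} → (A → A → Set) → A → A → A → (I → List A) → Set
IsWalkPacking E a b c W =
  (∀ i → Linked E (W i) × a ∈ W i × b ∈ W i × c ∈ W i) × (∀ i j → i ≡ j ⊎ EdgeDisjoint (W i) (W j))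

isWalkPacking? : ∀ {A : Set} {E : A → A → Set} {k} → DecidableEquality A → (∀ x y → Dec (E x y)) →
                 ∀ a b c (W : Fin k → List A) → Dec (IsWalkPacking E a b c W)
isWalkPacking? {A} _≟ᴬ_ E? a b c W =
  Fin.all? (λ i → linked? E? (W i) ×-dec (_∈?_ _≟ᴬ_ a (W i)) ×-dec (_∈?_ _≟ᴬ_ b (W i)) ×-dec (_∈?_ _≟ᴬ_ c (W i)))
  ×-dec
  Fin.all? (λ i → Fin.all? λ j → i ≟ j ⊎-dec
    All.all? (λ (x , y) → ¬? (_∈?_ _≟²_ (x , y) (steps (W j))) ×-dec ¬? (_∈?_ _≟²_ (y , x) (steps (W j)))) (steps (W i)))
  where
  _≟²_ : DecidableEquality (A × A)
  _≟²_ = ≡-dec _≟ᴬ_ _≟ᴬ_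

steps-Linked : ∀ {A : Set} {R : A → A → Set} ws → (∀ {x y} → (x , y) ∈ steps ws → R x y) → Linked R ws
steps-Linked []           h = []
steps-Linked (x ∷ [])     h = [-]
steps-Linked (x ∷ y ∷ ws) h = h (here refl) ∷ steps-Linked (y ∷ ws) (h ∘ there)

Linked-steps : ∀ {A : Set} {R : A → A → Set} {ws} → Linked R ws → ∀ {x y} → (x , y) ∈ steps ws → R x y
Linked-steps (r ∷ l) (here refl) = r
Linked-steps (r ∷ l) (there s)   = Linked-steps l s

Linked-reach : ∀ {A : Set} {R : A → A → Set} {z zs} → Linked R (z ∷ zs) → ∀ {x} → x ∈ z ∷ zs → Star R z x
Linked-reach l       (here refl) = ε
Linked-reach (r ∷ l) (there x∈)  = r ◅ Linked-reach l x∈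

Linked-connects : ∀ {A : Set} {R : A → A → Set} → (∀ {x y} → R x y → R y x) →
                  ∀ {ws} → Linked R ws → ∀ {x y} → x ∈ ws → y ∈ ws → Star R x y
Linked-connects R-sym {z ∷ zs} l x∈ y∈ = reverse R-sym (Linked-reach l x∈) ◅◅ Linked-reach l y∈

-- The relation for tree i consists of the steps of its walk, in either direction. The injection `ι`
-- selects k of the available walks, so a surplus of walks is harmless.
packing-from-walks : ∀ {n k} {I : Set} {G : Graph n} {a b c} {W : I → List (Fin n)} →
  IsWalkPacking (λ u v → adj G u v ≡ true) a b c W →
  (ι : Fin k → I) → Injective _≡_ _≡_ ι → HasPacking G a b c k
packing-from-walks {n} {k} {G = G} {a} {b} {c} {W} (walks , disj) ι ι-inj =
  packing-from-connections R (λ _ → R-sym) R⊆G R-disj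
    (λ i → connects i (proj₁ (covers i)) (proj₁ (proj₂ (covers i))))
    (λ i → connects i (proj₁ (covers i)) (proj₂ (proj₂ (covers i))))
  where
  R : Fin k → Fin n → Fin n → Set
  R i x y = (x , y) ∈ steps (W (ι i)) ⊎ (y , x) ∈ steps (W (ι i))
  covers : ∀ i → a ∈ W (ι i) × b ∈ W (ι i) × c ∈ W (ι i)
  covers i = proj₂ (walks (ι i))
  R-sym : ∀ {i x y} → R i x y → R i y x
  R-sym (inj₁ s) = inj₂ s
  R-sym (inj₂ s) = inj₁ s
  R⊆G : ∀ i {x y} → R i x y → adj G x y ≡ true
  R⊆G i (inj₁ s) = Linked-steps (proj₁ (walks (ι i))) s
  R⊆G i {x} {y} (inj₂ s) = trans (sym G x y) (Linked-steps (proj₁ (walks (ι i))) s)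
  R-disj : ∀ {i j x y} → R i x y → R j x y → i ≡ j
  R-disj {i} {j} r r′ with disj (ι i) (ι j)
  ... | inj₁ eq = ι-inj eq
  ... | inj₂ d with r | r′
  ...   | inj₁ s | inj₁ s′ = contradiction s′ (proj₁ (All.lookup d s))
  ...   | inj₁ s | inj₂ s′ = contradiction s′ (proj₂ (All.lookup d s))
  ...   | inj₂ s | inj₁ s′ = contradiction s′ (proj₂ (All.lookup d s))
  ...   | inj₂ s | inj₂ s′ = contradiction s′ (proj₁ (All.lookup d s))
  connects : ∀ i {x y} → x ∈ W (ι i) → y ∈ W (ι i) → Star (R i) x y
  connects i = Linked-connects R-sym (steps-Linked (W (ι i)) inj₁)

packing-swap₁₂ : ∀ {n k} {G : Graph n} {a b c} → HasPacking G b a c k → HasPacking G a b c k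
packing-swap₁₂ (T , st , disj) = T , (λ i → let (t , b∈ , a∈ , c∈) = st i in t , a∈ , b∈ , c∈) , disj

packing-swap₂₃ : ∀ {n k} {G : Graph n} {a b c} → HasPacking G a c b k → HasPacking G a b c k
packing-swap₂₃ (T , st , disj) = T , (λ i → let (t , a∈ , c∈ , b∈) = st i in t , a∈ , b∈ , c∈) , disj

-- Each element of `xs` deletes at most one value from an injective enumeration, by `punchIn` around
-- its index. Hence at least n - |xs| values survive.
outsiders : ∀ {n} (xs : List (Fin n)) →
  ∃ λ N → n ≤ length xs + N × Σ (Fin N → Fin n) λ τ → Injective _≡_ _≡_ τ × (∀ i → τ i ∉ xs)
outsiders {n} []       = n , ≤-refl , id , id , λ _ ()
outsiders (x ∷ xs) with outsiders xs
... | N , n≤ , τ , τ-inj , τ∉ with Fin.any? (λ i → τ i ≟ x)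
...   | no  none = N , m≤n⇒m≤1+n n≤ , τ , τ-inj ,
                   λ { i (here eq) → none (i , eq) ; i (there τi∈) → τ∉ i τi∈ }
outsiders (x ∷ xs) | suc N , n≤ , τ , τ-inj , τ∉ | yes (i₀ , eq₀) =
  N , ≤-trans n≤ (≤-reflexive (+-suc (length xs) N)) , τ ∘ punchIn i₀ ,
  Fin.punchIn-injective i₀ _ _ ∘ τ-inj ,
  λ { i (here eq) → Fin.punchInᵢ≢i i₀ i (τ-inj (trans eq (≡-sym eq₀))) ; i (there τi∈) → τ∉ _ τi∈ }

lookup-injective : ∀ {A : Set} {xs : List A} → Unique xs → Injective _≡_ _≡_ (lookup xs)
lookup-injective (_ ∷ _)  {zero}  {zero}  _  = refl
lookup-injective (x∉ ∷ _) {zero}  {suc j} eq = contradiction eq (All.lookup x∉ (∈-lookup j))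
lookup-injective (x∉ ∷ _) {suc i} {zero}  eq = contradiction (≡-sym eq) (All.lookup x∉ (∈-lookup i))
lookup-injective (_ ∷ u)  {suc i} {suc j} eq = cong suc (lookup-injective u eq)

multipartite : ∀ {n} → (Fin n → ℕ) → Graph n
multipartite g = record
  { adj = λ u v → not (g u ≡ᵇ g v)
  ; sym = λ u v → cong not (≡ᵇ-sym (g u) (g v))
  ; irr = λ v → cong not (≡ᵇ-refl (g v))
  }
  where
  ≡ᵇ-refl : ∀ x → (x ≡ᵇ x) ≡ true
  ≡ᵇ-refl zero    = refl
  ≡ᵇ-refl (suc x) = ≡ᵇ-refl x
  ≡ᵇ-sym : ∀ x y → (x ≡ᵇ y) ≡ (y ≡ᵇ x)
  ≡ᵇ-sym zero    zero    = refl
  ≡ᵇ-sym zero    (suc y) = refl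
  ≡ᵇ-sym (suc x) zero    = refl
  ≡ᵇ-sym (suc x) (suc y) = ≡ᵇ-sym x y

multipartite-adj : ∀ {n} {g : Fin n → ℕ} {u v} → g u ≢ g v → adj (multipartite g) u v ≡ true
multipartite-adj {g = g} {u} {v} ne with g u ≡ᵇ g v in eq
... | false = refl
... | true  = contradiction (≡ᵇ⇒≡ (g u) (g v) (subst Bool.T (≡-sym eq) _)) ne

multipartite-nonadj : ∀ {n} {g : Fin n → ℕ} {u v} → g u ≡ g v → u ≢ v → nonadj (multipartite g) u v ≡ true
multipartite-nonadj {g = g} {u} {v} g≡ u≢v with g u ≡ᵇ g v in eq | u ≟ v
... | _     | yes u≡v = contradiction u≡v u≢v
... | true  | no _    = refl
... | false | no _    = contradiction (subst Bool.T eq (≡⇒≡ᵇ (g u) (g v) g≡)) λ ()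

-- The part is given as an explicit exhaustive list, so that its size can be analysed by matching on
-- the list.
record Part {n} (g : Fin n → ℕ) (γ : ℕ) (xs : List (Fin n)) : Set where
  field
    unique   : Unique xs
    level    : ∀ {u} → u ∈ xs → g u ≡ γ
    complete : ∀ {u} → g u ≡ γ → u ∈ xs

open Part

-- Names a vertex by its part and its position there. Equality of literal codes and of part indices
-- evaluates even when the vertices are variables and the lists have unknown tails, so
-- `codeWalkPacking?` reduces to `yes` on concrete walks.
Code : ∀ {n r} → (Fin r → List (Fin n)) → Set
Code {r = r} parts = Σ (Fin r) (λ p → Fin (length (parts p)))

DifferentParts : ∀ {n r} {parts : Fin r → List (Fin n)} → Code parts → Code parts → Set
DifferentParts x y = proj₁ x ≢ proj₁ y

codeWalkPacking? : ∀ {n r k} (parts : Fin r → List (Fin n)) s₁ s₂ s₃ (W : Fin k → List (Code parts)) →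
                   Dec (IsWalkPacking (DifferentParts {parts = parts}) s₁ s₂ s₃ W)
codeWalkPacking? parts = isWalkPacking? (≡-dec _≟_ _≟_) (λ x y → ¬? (proj₁ x ≟ proj₁ y))

-- A packing inside the union of the parts meeting S, together with one star for every further
-- vertex: such a vertex is adjacent to all of S.
module _ {n r : ℕ} {g : Fin n → ℕ} (parts : Fin r → List (Fin n)) (γ : Fin r → ℕ)
         (γ-inj : Injective _≡_ _≡_ γ) (isPart : ∀ p → Part g (γ p) (parts p)) where

  private
    σ : Code parts → Fin n
    σ (p , i) = lookup (parts p) i

    all-parts : List (Fin n)
    all-parts = concat (tabulate parts)

    g-σ : ∀ x → g (σ x) ≡ γ (proj₁ x)
    g-σ (p , i) = level (isPart p) (∈-lookup i)

    -- Levels separate the parts and lists have no repetitions. This carries edge-disjointness from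
    -- codes over to vertices.
    σ-injective : ∀ {x y} → σ x ≡ σ y → x ≡ y
    σ-injective {p , i} {q , j} eq with γ-inj (trans (≡-sym (g-σ (p , i))) (trans (cong g eq) (g-σ (q , j))))
    ... | refl = cong (p ,_) (lookup-injective (unique (isPart p)) eq)

    σ∈ : ∀ x → σ x ∈ all-parts
    σ∈ (p , i) = ∈-concat⁺′ (∈-lookup {xs = parts p} i) (∈-tabulate⁺ p)

    outside-adj : ∀ {w} → w ∉ all-parts → ∀ x → g w ≢ g (σ x)
    outside-adj w∉ x eq = w∉ (∈-concat⁺′ (complete (isPart (proj₁ x)) (trans eq (g-σ x))) (∈-tabulate⁺ (proj₁ x)))

    steps-map : ∀ ws {u v} → (u , v) ∈ steps (map σ ws) → ∃ λ x → ∃ λ y → u ≡ σ x × v ≡ σ y × (x , y) ∈ steps ws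
    steps-map (x ∷ y ∷ ws) (here refl) = x , y , refl , refl , here refl
    steps-map (x ∷ y ∷ ws) (there s) with steps-map (y ∷ ws) s
    ... | x′ , y′ , eq , eq′ , s′ = x′ , y′ , eq , eq′ , there s′

  packing-extend : ∀ s₁ s₂ s₃ (W : List (List (Code parts))) {ok : True (codeWalkPacking? parts s₁ s₂ s₃ (lookup W))} →
                   ∀ {k} → k ≤ length W + (n ∸ length all-parts) →
                   HasPacking (multipartite g) (σ s₁) (σ s₂) (σ s₃) k
  packing-extend s₁ s₂ s₃ W {ok} {k} enough =
    packing-from-walks {W = V} (walks , disj) ι ι-injective
    where
    inner = toWitness ok
    a = σ s₁
    b = σ s₂
    c = σ s₃
    out = outsiders all-parts
    N = proj₁ out
    n≤ = proj₁ (proj₂ out)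
    τ = proj₁ (proj₂ (proj₂ out))
    τ-injective = proj₁ (proj₂ (proj₂ (proj₂ out)))
    τ∉ = proj₂ (proj₂ (proj₂ (proj₂ out)))

    star : Fin n → List (Fin n)
    star w = a ∷ w ∷ b ∷ w ∷ c ∷ []

    V : Fin (length W) ⊎ Fin N → List (Fin n)
    V (inj₁ i) = map σ (lookup W i)
    V (inj₂ j) = star (τ j)

    star-step : ∀ {w x y} → (x , y) ∈ steps (star w) → (x ≡ w × y ∈ all-parts) ⊎ (y ≡ w × x ∈ all-parts)
    star-step (here refl)                         = inj₂ (refl , σ∈ s₁)
    star-step (there (here refl))                 = inj₁ (refl , σ∈ s₂)
    star-step (there (there (here refl)))         = inj₂ (refl , σ∈ s₂)
    star-step (there (there (there (here refl)))) = inj₁ (refl , σ∈ s₃)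

    walks : ∀ i → Linked (λ u v → adj (multipartite g) u v ≡ true) (V i) × a ∈ V i × b ∈ V i × c ∈ V i
    walks (inj₁ i) with proj₁ inner i
    ... | l , a∈ , b∈ , c∈ =
      Linked.map⁺ (Linked.map (λ {x} {y} ne → multipartite-adj {g = g} λ eq → ne (γ-inj (trans (≡-sym (g-σ x)) (trans eq (g-σ y))))) l) ,
      ∈-map⁺ σ a∈ , ∈-map⁺ σ b∈ , ∈-map⁺ σ c∈
    walks (inj₂ j) =
      adj-from s₁ ∷ adj-to s₂ ∷ adj-from s₂ ∷ adj-to s₃ ∷ [-] ,
      here refl , there (there (here refl)) , there (there (there (there (here refl))))
      where
      adj-to : ∀ x → adj (multipartite g) (τ j) (σ x) ≡ true
      adj-to x = multipartite-adj {g = g} (outside-adj (τ∉ j) x)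
      adj-from : ∀ x → adj (multipartite g) (σ x) (τ j) ≡ true
      adj-from x = multipartite-adj {g = g} (outside-adj (τ∉ j) x ∘ ≡-sym)

    inside : ∀ ws {u v} → (u , v) ∈ steps (map σ ws) → u ∈ all-parts × v ∈ all-parts
    inside ws s with steps-map ws s
    ... | x , y , refl , refl , _ = σ∈ x , σ∈ y

    star-outside : ∀ j {u v} → (u , v) ∈ steps (star (τ j)) → ¬ (u ∈ all-parts × v ∈ all-parts)
    star-outside j s (u∈ , v∈) with star-step s
    ... | inj₁ (refl , _) = τ∉ j u∈
    ... | inj₂ (refl , _) = τ∉ j v∈

    star-meet : ∀ i j {u v} → (u , v) ∈ steps (star (τ i)) → (u , v) ∈ steps (star (τ j)) → τ i ≡ τ j
    star-meet i j s s′ with star-step s | star-step s′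
    ... | inj₁ (eq , _)   | inj₁ (eq′ , _) = trans (≡-sym eq) eq′
    ... | inj₂ (eq , _)   | inj₂ (eq′ , _) = trans (≡-sym eq) eq′
    ... | inj₁ (refl , _) | inj₂ (_ , u∈)  = contradiction u∈ (τ∉ i)
    ... | inj₂ (refl , _) | inj₁ (_ , v∈)  = contradiction v∈ (τ∉ i)

    star-meet′ : ∀ i j {u v} → (u , v) ∈ steps (star (τ i)) → (v , u) ∈ steps (star (τ j)) → τ i ≡ τ j
    star-meet′ i j s s′ with star-step s | star-step s′
    ... | inj₁ (eq , _)   | inj₂ (eq′ , _) = trans (≡-sym eq) eq′
    ... | inj₂ (eq , _)   | inj₁ (eq′ , _) = trans (≡-sym eq) eq′
    ... | inj₁ (refl , _) | inj₁ (_ , u∈)  = contradiction u∈ (τ∉ i)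
    ... | inj₂ (refl , _) | inj₂ (_ , v∈)  = contradiction v∈ (τ∉ i)

    disj : ∀ i j → i ≡ j ⊎ EdgeDisjoint (V i) (V j)
    disj (inj₁ i) (inj₁ j) with proj₂ inner i j
    ... | inj₁ refl = inj₁ refl
    ... | inj₂ d    = inj₂ (All.tabulate λ s → apart s , apart′ s)
      where
      apart : ∀ {u v} → (u , v) ∈ steps (V (inj₁ i)) → (u , v) ∉ steps (V (inj₁ j))
      apart s s′ with steps-map (lookup W i) s | steps-map (lookup W j) s′
      ... | x , y , refl , refl , t | x′ , y′ , eq , eq′ , t′ with σ-injective eq | σ-injective eq′
      ...   | refl | refl = proj₁ (All.lookup d t) t′
      apart′ : ∀ {u v} → (u , v) ∈ steps (V (inj₁ i)) → (v , u) ∉ steps (V (inj₁ j))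
      apart′ s s′ with steps-map (lookup W i) s | steps-map (lookup W j) s′
      ... | x , y , refl , refl , t | x′ , y′ , eq , eq′ , t′ with σ-injective eq | σ-injective eq′
      ...   | refl | refl = proj₂ (All.lookup d t) t′
    disj (inj₁ i) (inj₂ j) = inj₂ (All.tabulate λ s → let (u∈ , v∈) = inside (lookup W i) s in
      (λ s′ → star-outside j s′ (u∈ , v∈)) , (λ s′ → star-outside j s′ (v∈ , u∈)))
    disj (inj₂ i) (inj₁ j) = inj₂ (All.tabulate λ s →
      (λ s′ → star-outside i s (inside (lookup W j) s′)) ,
      (λ s′ → let (v∈ , u∈) = inside (lookup W j) s′ in star-outside i s (u∈ , v∈)))
    disj (inj₂ i) (inj₂ j) with i ≟ j
    ... | yes refl = inj₁ refl
    ... | no  i≢j  = inj₂ (All.tabulate λ s →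
      (λ s′ → i≢j (τ-injective (star-meet i j s s′))) , (λ s′ → i≢j (τ-injective (star-meet′ i j s s′))))

    k≤ : k ≤ length W + N
    k≤ = ≤-trans enough (+-monoʳ-≤ (length W) (m≤n+o⇒m∸n≤o n (length all-parts) n≤))

    ι : Fin k → Fin (length W) ⊎ Fin N
    ι i = splitAt (length W) (inject≤ i k≤)

    ι-injective : Injective _≡_ _≡_ ι
    ι-injective {i} {j} eq = Fin.inject≤-injective k≤ k≤ i j
      (trans (≡-sym (Fin.join-splitAt (length W) N _)) (trans (cong (join (length W) N) eq) (Fin.join-splitAt (length W) N _)))

-- Lists the prescribed vertices first, so that the members of S have fixed codes such as `p₀` or
-- `q₀` whatever the rest of the part is.
part-from : ∀ {n} (g : Fin n → ℕ) γ ps → Unique ps → (∀ {u} → u ∈ ps → g u ≡ γ) → ∃ λ rs → Part g γ (ps ++ rs)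
part-from {n} g γ ps ps-unique ps-level = filter P? (allFin n) , record
  { unique   = Unique.++⁺ ps-unique (Unique.filter⁺ P? (Unique.allFin⁺ n)) λ (u∈ , u∈′) → proj₂ (proj₂ (∈-filter⁻ P? {xs = allFin n} u∈′)) u∈
  ; level    = λ u∈ → [ ps-level , (λ u∈′ → proj₁ (proj₂ (∈-filter⁻ P? {xs = allFin n} u∈′))) ]′ (∈-++⁻ ps u∈)
  ; complete = λ {u} gu≡γ → in-part u gu≡γ
  }
  where
  P? : ∀ u → Dec (g u ≡ γ × u ∉ ps)
  P? u = (g u ℕ.≟ γ) ×-dec ¬? (_∈?_ _≟_ u ps)
  in-part : ∀ u → g u ≡ γ → u ∈ ps ++ filter P? (allFin n)
  in-part u gu≡γ with _∈?_ _≟_ u ps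
  ... | yes u∈ = ∈-++⁺ˡ u∈
  ... | no  u∉ = ∈-++⁺ʳ ps (∈-filter⁺ P? (∈-allFin u) (gu≡γ , u∉))

part-length≤ : ∀ {n s} {g : Fin n → ℕ} {γ xs} → Part g γ xs → (h : Fin n → Fin s) →
               (∀ {u v} → g u ≡ γ → g v ≡ γ → h u ≡ h v → u ≡ v) → length xs ≤ s
part-length≤ {xs = xs} part h h-inj = Fin.injective⇒≤ {f = h ∘ lookup xs} λ eq →
  lookup-injective (unique part) (h-inj (level part (∈-lookup _)) (level part (∈-lookup _)) eq)

part-length≥ : ∀ {n s} {g : Fin n → ℕ} {γ xs} → Part g γ xs → (e : Fin s → Fin n) →
               Injective _≡_ _≡_ e → (∀ i → g (e i) ≡ γ) → s ≤ length xs
part-length≥ {xs = xs} part e e-inj ge = Fin.injective⇒≤ {f = λ i → index (e∈ i)} λ {i} {j} eq →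
  e-inj (trans (lookup-index (e∈ i)) (trans (cong (lookup xs) eq) (≡-sym (lookup-index (e∈ j)))))
  where
  e∈ : ∀ i → e i ∈ xs
  e∈ i = complete part (ge i)

pattern p₀ = 0F , 0F
pattern p₁ = 0F , 1F
pattern p₂ = 0F , 2F
pattern p₃ = 0F , 3F
pattern p₄ = 0F , 4F
pattern p₅ = 0F , 5F
pattern q₀ = 1F , 0F
pattern q₁ = 1F , 1F
pattern q₂ = 1F , 2F
pattern q₃ = 1F , 3F
pattern q₄ = 1F , 4F
pattern q₅ = 1F , 5F
pattern r₀ = 2F , 0F
pattern r₁ = 2F , 1F

module _ {n : ℕ} {g : Fin n → ℕ} where

  one-part : ∀ {α xs} → Part g α xs → let parts = Vec.lookup (xs ∷ []) in
             ∀ s₁ s₂ s₃ W {ok : True (codeWalkPacking? parts s₁ s₂ s₃ (lookup W))} {k} →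
             k ≤ length W + (n ∸ length (concat (tabulate parts))) →
             HasPacking (multipartite g) (lookup (parts (proj₁ s₁)) (proj₂ s₁)) (lookup (parts (proj₁ s₂)) (proj₂ s₂))
                                         (lookup (parts (proj₁ s₃)) (proj₂ s₃)) k
  one-part {α} {xs} p s₁ s₂ s₃ W {ok} =
    packing-extend (Vec.lookup (xs ∷ [])) (Vec.lookup (α ∷ [])) (λ { {zero} {zero} _ → refl }) (λ { zero → p }) s₁ s₂ s₃ W {ok}

  two-parts : ∀ {α β xs ys} → α ≢ β → Part g α xs → Part g β ys → let parts = Vec.lookup (xs ∷ ys ∷ []) in
              ∀ s₁ s₂ s₃ W {ok : True (codeWalkPacking? parts s₁ s₂ s₃ (lookup W))} {k} →
              k ≤ length W + (n ∸ length (concat (tabulate parts))) →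
              HasPacking (multipartite g) (lookup (parts (proj₁ s₁)) (proj₂ s₁)) (lookup (parts (proj₁ s₂)) (proj₂ s₂))
                                          (lookup (parts (proj₁ s₃)) (proj₂ s₃)) k
  two-parts {α} {β} {xs} {ys} α≢β p q s₁ s₂ s₃ W {ok} =
    packing-extend (Vec.lookup (xs ∷ ys ∷ [])) (Vec.lookup (α ∷ β ∷ [])) inj (λ { zero → p ; (suc zero) → q }) s₁ s₂ s₃ W {ok}
    where
    inj : Injective _≡_ _≡_ (Vec.lookup (α ∷ β ∷ []))
    inj {zero}     {zero}     _  = refl
    inj {zero}     {suc zero} eq = contradiction eq α≢β
    inj {suc zero} {zero}     eq = contradiction (≡-sym eq) α≢β
    inj {suc zero} {suc zero} _  = refl

  three-parts : ∀ {α β γ xs ys zs} → α ≢ β → α ≢ γ → β ≢ γ → Part g α xs → Part g β ys → Part g γ zs →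
                let parts = Vec.lookup (xs ∷ ys ∷ zs ∷ []) in
                ∀ s₁ s₂ s₃ W {ok : True (codeWalkPacking? parts s₁ s₂ s₃ (lookup W))} {k} →
                k ≤ length W + (n ∸ length (concat (tabulate parts))) →
                HasPacking (multipartite g) (lookup (parts (proj₁ s₁)) (proj₂ s₁)) (lookup (parts (proj₁ s₂)) (proj₂ s₂))
                                            (lookup (parts (proj₁ s₃)) (proj₂ s₃)) k
  three-parts {α} {β} {γ} {xs} {ys} {zs} α≢β α≢γ β≢γ p q r s₁ s₂ s₃ W {ok} =
    packing-extend (Vec.lookup (xs ∷ ys ∷ zs ∷ [])) (Vec.lookup (α ∷ β ∷ γ ∷ [])) inj
      (λ { zero → p ; (suc zero) → q ; (suc (suc zero)) → r }) s₁ s₂ s₃ W {ok}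
    where
    inj : Injective _≡_ _≡_ (Vec.lookup (α ∷ β ∷ γ ∷ []))
    inj {zero}           {zero}           _  = refl
    inj {zero}           {suc zero}       eq = contradiction eq α≢β
    inj {zero}           {suc (suc zero)} eq = contradiction eq α≢γ
    inj {suc zero}       {zero}           eq = contradiction (≡-sym eq) α≢β
    inj {suc zero}       {suc zero}       _  = refl
    inj {suc zero}       {suc (suc zero)} eq = contradiction eq β≢γ
    inj {suc (suc zero)} {zero}           eq = contradiction (≡-sym eq) α≢γ
    inj {suc (suc zero)} {suc zero}       eq = contradiction (≡-sym eq) β≢γ
    inj {suc (suc zero)} {suc (suc zero)} _  = refl

  part-of : ∀ a → ∃ λ xs → Part g (g a) (a ∷ xs)
  part-of a = part-from g (g a) (a ∷ []) ([] ∷ []) λ { (here refl) → refl }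

  part-of₂ : ∀ {a b} → a ≢ b → g a ≡ g b → ∃ λ xs → Part g (g a) (a ∷ b ∷ xs)
  part-of₂ {a} {b} a≢b ab = part-from g (g a) (a ∷ b ∷ []) ((a≢b ∷ []) ∷ [] ∷ [])
    λ { (here refl) → refl ; (there (here refl)) → ≡-sym ab }

  part-of₃ : ∀ {a b c} → Distinct3 a b c → g a ≡ g b → g a ≡ g c → ∃ λ xs → Part g (g a) (a ∷ b ∷ c ∷ xs)
  part-of₃ {a} {b} {c} (a≢b , a≢c , b≢c) ab ac = part-from g (g a) (a ∷ b ∷ c ∷ []) ((a≢b ∷ a≢c ∷ []) ∷ (b≢c ∷ []) ∷ [] ∷ [])
    λ { (here refl) → refl ; (there (here refl)) → ≡-sym ab ; (there (there (here refl))) → ≡-sym ac }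

  by-levels : ∀ {k} →
    (∀ a b c → Distinct3 a b c → g a ≡ g b → g a ≡ g c → HasPacking (multipartite g) a b c k) →
    (∀ a b c → a ≢ b → g a ≡ g b → g a ≢ g c → HasPacking (multipartite g) a b c k) →
    (∀ a b c → g a ≢ g b → g a ≢ g c → g b ≢ g c → HasPacking (multipartite g) a b c k) →
    ∀ a b c → Distinct3 a b c → HasPacking (multipartite g) a b c k
  by-levels same pair different a b c abc@(a≢b , a≢c , b≢c) with g a ℕ.≟ g b | g a ℕ.≟ g c | g b ℕ.≟ g c
  ... | yes ab | yes ac | _      = same a b c abc ab ac
  ... | yes ab | no ac  | _      = pair a b c a≢b ab ac
  ... | no ab  | yes ac | _      = packing-swap₂₃ (pair a c b a≢c ac ab)
  ... | no ab  | no ac  | yes bc = packing-swap₁₂ (packing-swap₂₃ (pair b c a b≢c bc (ab ∘ ≡-sym)))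
  ... | no ab  | no ac  | no bc  = different a b c ab ac bc

-- Packings of n - 2 trees: at most one part of size two

module _ {n m : ℕ} (n≡3+m : n ≡ 3 + m) {g : Fin n → ℕ}
         (part≤2 : ∀ {γ xs} → Part g γ xs → length xs ≤ 2)
         (part≡2 : ∀ {γ xs} → Part g γ xs → 2 ≤ length xs → γ ≡ 0) where

  private
    -- The budget for inner trees: if the parts meeting S have 2 + j vertices in total, the other
    -- vertices provide n - 2 - j stars and j inner trees must be found.
    enough : ∀ j → 1 + m ≤ j + (n ∸ (2 + j))
    enough j = subst (λ n → 1 + m ≤ j + (n ∸ (2 + j))) (≡-sym n≡3+m) (m≤n+m∸n (1 + m) j)

    same : ∀ a b c → Distinct3 a b c → g a ≡ g b → g a ≡ g c → HasPacking (multipartite g) a b c (1 + m)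
    same a b c abc ab ac = contradiction (part≤2 (proj₂ (part-of₃ abc ab ac))) λ { (s≤s (s≤s ())) }

    pair : ∀ a b c → a ≢ b → g a ≡ g b → g a ≢ g c → HasPacking (multipartite g) a b c (1 + m)
    pair a b c a≢b ab ac with part-of₂ {g = g} a≢b ab | part-of {g = g} c
    ... | []    , p | []    , r = two-parts ac p r p₀ p₁ q₀ ((p₀ ∷ q₀ ∷ p₁ ∷ []) ∷ []) (enough 1)
    ... | []    , p | _ ∷ _ , r = contradiction (trans (part≡2 p (s≤s (s≤s z≤n))) (≡-sym (part≡2 r (s≤s (s≤s z≤n))))) ac
    ... | _ ∷ _ , p | _         = contradiction (part≤2 p) λ { (s≤s (s≤s ())) }

    different : ∀ a b c → g a ≢ g b → g a ≢ g c → g b ≢ g c → HasPacking (multipartite g) a b c (1 + m)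
    different a b c ab ac bc with part-of {g = g} a | part-of {g = g} b | part-of {g = g} c
    ... | []     , p | [] , q | [] , r = three-parts ab ac bc p q r p₀ q₀ r₀ ((p₀ ∷ q₀ ∷ r₀ ∷ []) ∷ []) (enough 1)
    ... | _ ∷ [] , p | [] , q | [] , r =
      three-parts ab ac bc p q r p₀ q₀ r₀ ((p₀ ∷ q₀ ∷ r₀ ∷ []) ∷ (q₀ ∷ p₁ ∷ r₀ ∷ p₀ ∷ []) ∷ []) (enough 2)
    ... | [] , p | _ ∷ [] , q | [] , r = packing-swap₁₂
      (three-parts (ab ∘ ≡-sym) bc ac q p r p₀ q₀ r₀ ((p₀ ∷ q₀ ∷ r₀ ∷ []) ∷ (q₀ ∷ p₁ ∷ r₀ ∷ p₀ ∷ []) ∷ []) (enough 2))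
    ... | [] , p | [] , q | _ ∷ [] , r = packing-swap₂₃ (packing-swap₁₂
      (three-parts (ac ∘ ≡-sym) (bc ∘ ≡-sym) ab r p q p₀ q₀ r₀ ((p₀ ∷ q₀ ∷ r₀ ∷ []) ∷ (q₀ ∷ p₁ ∷ r₀ ∷ p₀ ∷ []) ∷ []) (enough 2)))
    ... | _ ∷ _ ∷ _ , p | _ | _ = contradiction (part≤2 p) λ { (s≤s (s≤s ())) }
    ... | _ | _ ∷ _ ∷ _ , q | _ = contradiction (part≤2 q) λ { (s≤s (s≤s ())) }
    ... | _ | _ | _ ∷ _ ∷ _ , r = contradiction (part≤2 r) λ { (s≤s (s≤s ())) }
    ... | _ ∷ _ , p | _ ∷ _ , q | _         = contradiction (trans (part≡2 p (s≤s (s≤s z≤n))) (≡-sym (part≡2 q (s≤s (s≤s z≤n))))) ab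
    ... | _ ∷ _ , p | _         | _ ∷ _ , r = contradiction (trans (part≡2 p (s≤s (s≤s z≤n))) (≡-sym (part≡2 r (s≤s (s≤s z≤n))))) ac
    ... | _         | _ ∷ _ , q | _ ∷ _ , r = contradiction (trans (part≡2 q (s≤s (s≤s z≤n))) (≡-sym (part≡2 r (s≤s (s≤s z≤n))))) bc

  parts≤2-packing : ∀ a b c → Distinct3 a b c → HasPacking (multipartite g) a b c (1 + m)
  parts≤2-packing = by-levels same pair different

-- Packings of n - 3 trees: at most one part of size three

module _ {n m : ℕ} (n≡3+m : n ≡ 3 + m) {g : Fin n → ℕ}
         (part≤3 : ∀ {γ xs} → Part g γ xs → length xs ≤ 3)
         (part≡3 : ∀ {γ xs} → Part g γ xs → 3 ≤ length xs → γ ≡ 0) where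

  private
    -- Now 3 + j vertices in the parts meeting S call for j inner trees; a single part of size three
    -- calls for none.
    enough : ∀ j → m ≤ j + (n ∸ (3 + j))
    enough j = subst (λ n → m ≤ j + (n ∸ (3 + j))) (≡-sym n≡3+m) (m≤n+m∸n m j)

    too-long : ∀ {γ w x y z xs} → ¬ Part g γ (w ∷ x ∷ y ∷ z ∷ xs)
    too-long p = contradiction (part≤3 p) λ { (s≤s (s≤s (s≤s ()))) }

    both-long : ∀ {α β x y z xs u v w ys} → α ≢ β → Part g α (x ∷ y ∷ z ∷ xs) → ¬ Part g β (u ∷ v ∷ w ∷ ys)
    both-long α≢β p q = α≢β (trans (part≡3 p (s≤s (s≤s (s≤s z≤n)))) (≡-sym (part≡3 q (s≤s (s≤s (s≤s z≤n))))))

    same : ∀ a b c → Distinct3 a b c → g a ≡ g b → g a ≡ g c → HasPacking (multipartite g) a b c m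
    same a b c abc ab ac with part-of₃ {g = g} abc ab ac
    ... | []    , p = one-part p p₀ p₁ p₂ [] (enough 0)
    ... | _ ∷ _ , p = contradiction p too-long

    pair : ∀ a b c → a ≢ b → g a ≡ g b → g a ≢ g c → HasPacking (multipartite g) a b c m
    pair a b c a≢b ab ac with part-of₂ {g = g} a≢b ab | part-of {g = g} c
    ... | []     , p | []         , r = two-parts ac p r p₀ p₁ q₀ [] (enough 0)
    ... | []     , p | _ ∷ []     , r = two-parts ac p r p₀ p₁ q₀ ((p₀ ∷ q₀ ∷ p₁ ∷ []) ∷ []) (enough 1)
    ... | []     , p | _ ∷ _ ∷ [] , r = two-parts ac p r p₀ p₁ q₀
      ((q₀ ∷ p₀ ∷ q₁ ∷ p₁ ∷ []) ∷ (q₀ ∷ p₁ ∷ q₂ ∷ p₀ ∷ []) ∷ []) (enough 2)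
    ... | _ ∷ [] , p | []         , r = two-parts ac p r p₀ p₁ q₀ ((p₀ ∷ q₀ ∷ p₁ ∷ []) ∷ []) (enough 1)
    ... | _ ∷ [] , p | _ ∷ []     , r = two-parts ac p r p₀ p₁ q₀
      ((p₀ ∷ q₀ ∷ p₁ ∷ []) ∷ (p₀ ∷ q₁ ∷ p₁ ∷ q₁ ∷ p₂ ∷ q₀ ∷ []) ∷ []) (enough 2)
    ... | _ ∷ _ ∷ _ , p | _ = contradiction p too-long
    ... | _ | _ ∷ _ ∷ _ ∷ _ , r = contradiction r too-long
    ... | _ ∷ [] , p | _ ∷ _ ∷ [] , r = contradiction r (both-long ac p)

    -- Ordering the parts by size leaves seven shapes, because two parts of size three cannot occur.
    -- The largest, 3 + 2 + 2, needs four inner trees on seven vertices.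
    sorted : ∀ {a b c} xs ys zs → g a ≢ g b → g a ≢ g c → g b ≢ g c →
             Part g (g a) (a ∷ xs) → Part g (g b) (b ∷ ys) → Part g (g c) (c ∷ zs) →
             length ys ≤ length xs → length zs ≤ length ys → HasPacking (multipartite g) a b c m
    sorted [] [] [] ab ac bc p q r _ _ = three-parts ab ac bc p q r p₀ q₀ r₀ [] (enough 0)
    sorted (_ ∷ []) [] [] ab ac bc p q r _ _ = three-parts ab ac bc p q r p₀ q₀ r₀ ((p₀ ∷ q₀ ∷ r₀ ∷ []) ∷ []) (enough 1)
    sorted (_ ∷ []) (_ ∷ []) [] ab ac bc p q r _ _ = three-parts ab ac bc p q r p₀ q₀ r₀
      ((p₀ ∷ q₀ ∷ r₀ ∷ []) ∷ (q₀ ∷ p₁ ∷ r₀ ∷ p₀ ∷ []) ∷ []) (enough 2)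
    sorted (_ ∷ []) (_ ∷ []) (_ ∷ []) ab ac bc p q r _ _ = three-parts ab ac bc p q r p₀ q₀ r₀
      ((p₀ ∷ q₀ ∷ r₀ ∷ []) ∷ (q₀ ∷ r₁ ∷ p₀ ∷ r₀ ∷ []) ∷ (p₀ ∷ q₁ ∷ r₀ ∷ q₁ ∷ p₁ ∷ q₀ ∷ []) ∷ []) (enough 3)
    sorted (_ ∷ _ ∷ []) [] [] ab ac bc p q r _ _ = three-parts ab ac bc p q r p₀ q₀ r₀
      ((p₀ ∷ q₀ ∷ r₀ ∷ []) ∷ (p₀ ∷ r₀ ∷ p₁ ∷ q₀ ∷ []) ∷ []) (enough 2)
    sorted (_ ∷ _ ∷ []) (_ ∷ []) [] ab ac bc p q r _ _ = three-parts ab ac bc p q r p₀ q₀ r₀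
      ((p₀ ∷ q₀ ∷ r₀ ∷ []) ∷ (p₀ ∷ r₀ ∷ p₁ ∷ q₀ ∷ []) ∷ (r₀ ∷ q₁ ∷ p₀ ∷ q₁ ∷ p₂ ∷ q₀ ∷ []) ∷ []) (enough 3)
    sorted (_ ∷ _ ∷ []) (_ ∷ []) (_ ∷ []) ab ac bc p q r _ _ = three-parts ab ac bc p q r p₀ q₀ r₀
      ((p₀ ∷ q₀ ∷ r₀ ∷ []) ∷ (p₀ ∷ r₀ ∷ p₁ ∷ q₀ ∷ []) ∷ (r₀ ∷ q₁ ∷ p₀ ∷ q₁ ∷ p₂ ∷ q₀ ∷ []) ∷ (q₀ ∷ r₁ ∷ p₀ ∷ r₁ ∷ p₂ ∷ r₀ ∷ []) ∷ []) (enough 4)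
    sorted (_ ∷ _ ∷ _ ∷ _) _ _ _ _ _ p _ _ _ _ = contradiction p too-long
    sorted (_ ∷ _ ∷ []) (_ ∷ _ ∷ _) _ ab _ _ p q _ _ _ = contradiction q (both-long ab p)
    sorted [] (_ ∷ _) _ _ _ _ _ _ _ () _
    sorted (_ ∷ []) (_ ∷ _ ∷ _) _ _ _ _ _ _ _ (s≤s ()) _
    sorted _ [] (_ ∷ _) _ _ _ _ _ _ _ ()
    sorted _ (_ ∷ []) (_ ∷ _ ∷ _) _ _ _ _ _ _ _ (s≤s ())

    different : ∀ a b c → g a ≢ g b → g a ≢ g c → g b ≢ g c → HasPacking (multipartite g) a b c m
    different a b c ab ac bc with part-of {g = g} a | part-of {g = g} b | part-of {g = g} c
    ... | xs , p | ys , q | zs , r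
      with ≤-total (length ys) (length xs) | ≤-total (length zs) (length xs) | ≤-total (length zs) (length ys)
    ... | inj₁ y≤x | _        | inj₁ z≤y = sorted xs ys zs ab ac bc p q r y≤x z≤y
    ... | inj₁ y≤x | inj₁ z≤x | inj₂ y≤z = packing-swap₂₃ (sorted xs zs ys ac ab (bc ∘ ≡-sym) p r q z≤x y≤z)
    ... | inj₁ y≤x | inj₂ x≤z | inj₂ _   = packing-swap₂₃ (packing-swap₁₂ (sorted zs xs ys (ac ∘ ≡-sym) (bc ∘ ≡-sym) ab r p q x≤z y≤x))
    ... | inj₂ x≤y | inj₁ z≤x | _        = packing-swap₁₂ (sorted ys xs zs (ab ∘ ≡-sym) bc ac q p r x≤y z≤x)
    ... | inj₂ x≤y | inj₂ x≤z | inj₁ z≤y =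
      packing-swap₁₂ (packing-swap₂₃ (sorted ys zs xs bc (ab ∘ ≡-sym) (ac ∘ ≡-sym) q r p z≤y x≤z))
    ... | inj₂ x≤y | inj₂ _   | inj₂ y≤z =
      packing-swap₂₃ (packing-swap₁₂ (packing-swap₂₃ (sorted zs ys xs (bc ∘ ≡-sym) (ac ∘ ≡-sym) (ab ∘ ≡-sym) r q p y≤z x≤y)))

  parts≤3-packing : ∀ a b c → Distinct3 a b c → HasPacking (multipartite g) a b c m
  parts≤3-packing = by-levels same pair different

-- Extremal graphs

deg-from-codeg : ∀ {n m} (G : Graph n) r v → n ≡ 3 + m → r ≤ codeg G v → deg G v + r ≤ 2 + m
deg-from-codeg {n} {m} G r v n≡3+m r≤ = +-cancelʳ-≤ 1 _ _ (begin
  deg G v + r + 1           ≤⟨ +-monoˡ-≤ 1 (+-monoʳ-≤ (deg G v) r≤) ⟩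
  deg G v + codeg G v + 1   ≡⟨ deg+codeg G v ⟩
  n                         ≡⟨ n≡3+m ⟩
  3 + m                     ≡⟨ +-comm 1 (2 + m) ⟩
  2 + m + 1                 ∎)
  where open ≤-Reasoning

codeg≥1 : ∀ {n} (G : Graph n) v u → nonadj G v u ≡ true → 1 ≤ codeg G v
codeg≥1 G v u nu = ≤-trans (≤-reflexive (≡-sym (cong [_]ᵇ nu))) (term≤sum (λ j → [ nonadj G v j ]ᵇ) u)

vertex : ∀ {n m} i → n ≡ 3 + m → i < 3 + m → Σ (Fin n) λ v → toℕ v ≡ i
vertex i n≡3+m i< = fromℕ< i<n , Fin.toℕ-fromℕ< i<n
  where i<n = subst (i <_) (≡-sym n≡3+m) i<

toℕ-≢ : ∀ {n i j} {u v : Fin n} → toℕ u ≡ i → toℕ v ≡ j → i ≢ j → u ≢ v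
toℕ-≢ u≡i v≡j i≢j refl = i≢j (trans (≡-sym u≡i) v≡j)

module _ {n m : ℕ} (n≡3+m : n ≡ 3 + m) where

  private
    v₀ = vertex 0 n≡3+m (s≤s z≤n)
    v₁ = vertex 1 n≡3+m (s≤s (s≤s z≤n))
    v₂ = vertex 2 n≡3+m (s≤s (s≤s (s≤s z≤n)))
    last = vertex (2 + m) n≡3+m ≤-refl

    distinct₀₁₂ : Distinct3 (proj₁ v₀) (proj₁ v₁) (proj₁ v₂)
    distinct₀₁₂ = toℕ-≢ (proj₂ v₀) (proj₂ v₁) (λ ()) , toℕ-≢ (proj₂ v₀) (proj₂ v₂) (λ ()) , toℕ-≢ (proj₂ v₁) (proj₂ v₂) (λ ())

  module MinusEdge where

    -- One part {0, 1}; all other parts are singletons.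
    g : Fin n → ℕ
    g v = pred (toℕ v)

    private
      G : Graph n
      G = multipartite g

      -- The only distinct numbers that `pred` identifies are 0 and 1, and `sign` separates them; it
      -- therefore embeds every part into `Fin 2`.
      sign : ℕ → Fin 2
      sign zero    = zero
      sign (suc _) = suc zero

      pred-sign-injective : ∀ i j → pred i ≡ pred j → sign i ≡ sign j → i ≡ j
      pred-sign-injective zero    zero    _  _ = refl
      pred-sign-injective (suc i) (suc j) eq _ = cong suc eq

      pred≡suc-injective : ∀ i j {γ} → pred i ≡ suc γ → pred j ≡ suc γ → i ≡ j
      pred≡suc-injective (suc i) (suc j) eq eq′ = cong suc (trans eq (≡-sym eq′))

      part≤2 : ∀ {γ xs} → Part g γ xs → length xs ≤ 2
      part≤2 p = part-length≤ p (sign ∘ toℕ) λ {u} {v} gu gv eq →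
        Fin.toℕ-injective (pred-sign-injective (toℕ u) (toℕ v) (trans gu (≡-sym gv)) eq)

      part≡2 : ∀ {γ xs} → Part g γ xs → 2 ≤ length xs → γ ≡ 0
      part≡2 {zero}  p _  = refl
      part≡2 {suc γ} p 2≤ = contradiction (≤-trans 2≤ (part-length≤ p (λ _ → zero {0}) λ {u} {v} gu gv _ →
        Fin.toℕ-injective (pred≡suc-injective (toℕ u) (toℕ v) gu gv))) λ { (s≤s ()) }

      1≤codeg : 1 ≤ codeg G (proj₁ v₀)
      1≤codeg = codeg≥1 G (proj₁ v₀) (proj₁ v₁) (multipartite-nonadj {g = g} (trans (cong pred (proj₂ v₀)) (cong pred (≡-sym (proj₂ v₁)))) (proj₁ distinct₀₁₂))

      -- Vertex 0 is not adjacent to vertex 1, so its degree is at most n - 2 = 1 + m.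
      no-more : ¬ HasPacking G (proj₁ v₀) (proj₁ v₁) (proj₁ v₂) (2 + m)
      no-more p = <-irrefl refl (begin-strict
        2 + m                 <⟨ n<1+n _ ⟩
        1 + (2 + m)           ≡⟨ +-comm 1 (2 + m) ⟩
        2 + m + 1             ≤⟨ +-monoˡ-≤ 1 (packing≤deg p (proj₁ distinct₀₁₂)) ⟩
        deg G (proj₁ v₀) + 1  ≤⟨ deg-from-codeg G 1 (proj₁ v₀) n≡3+m 1≤codeg ⟩
        2 + m                 ∎)
        where open ≤-Reasoning

      lower : ∀ (G : Graph n) → Lambda3≡ G (1 + m) → n C 2 ∸ 1 ≤ edgeCount G
      lower G (pack , _) = ∑codeg≤2*q⇒nC2∸q≤edgeCount G 1 (m≤n⇒m≤1+n (∑codeg≤2 n≡3+m G pack))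

    isG : IsG n (1 + m) (n C 2 ∸ 1)
    isG = (G , λ₃ , ≤-antisym (∑codeg≥2*q∸1⇒edgeCount≤nC2∸q G 1 (s≤s (≤-trans 1≤codeg (term≤sum (codeg G) (proj₁ v₀))))) (lower G λ₃)) , lower
      where
      λ₃ : Lambda3≡ G (1 + m)
      λ₃ = parts≤2-packing n≡3+m part≤2 part≡2 , proj₁ v₀ , proj₁ v₁ , proj₁ v₂ , distinct₀₁₂ , no-more

  module MinusTriangleAndMatching where

    -- The parts are {0, 1, 2}, {3, 4}, {5, 6}, …
    g : Fin n → ℕ
    g v = ⌊ pred (toℕ v) /2⌋

    private
      G : Graph n
      G = multipartite g

      parity : ℕ → Fin 2
      parity zero          = zero
      parity (suc zero)    = suc zero
      parity (suc (suc i)) = parity i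

      half-parity-injective : ∀ i j → ⌊ i /2⌋ ≡ ⌊ j /2⌋ → parity i ≡ parity j → i ≡ j
      half-parity-injective zero          zero          _  _ = refl
      half-parity-injective (suc zero)    (suc zero)    _  _ = refl
      half-parity-injective (suc (suc i)) (suc (suc j)) eq p = cong (2 +_) (half-parity-injective i j (suc-injective eq) p)
      half-parity-injective zero          (suc zero)    _  ()
      half-parity-injective (suc zero)    zero          _  ()

      -- Parity separates the two members of a pair; the extra value is for vertex 0, the third
      -- member of the part at level 0.
      position : ℕ → Fin 3
      position zero    = zero
      position (suc i) = suc (parity i)

      position-injective : ∀ i j → ⌊ pred i /2⌋ ≡ ⌊ pred j /2⌋ → position i ≡ position j → i ≡ j
      position-injective zero    zero    _  _ = refl
      position-injective (suc i) (suc j) eq p = cong suc (half-parity-injective i j eq (Fin.suc-injective p))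

      nonzero-injective : ∀ i j {γ} → ⌊ pred i /2⌋ ≡ suc γ → ⌊ pred j /2⌋ ≡ suc γ → parity (pred i) ≡ parity (pred j) → i ≡ j
      nonzero-injective (suc i) (suc j) eq eq′ p = cong suc (half-parity-injective i j (trans eq (≡-sym eq′)) p)

      part≤3 : ∀ {γ xs} → Part g γ xs → length xs ≤ 3
      part≤3 p = part-length≤ p (position ∘ toℕ) λ {u} {v} gu gv eq →
        Fin.toℕ-injective (position-injective (toℕ u) (toℕ v) (trans gu (≡-sym gv)) eq)

      part≡3 : ∀ {γ xs} → Part g γ xs → 3 ≤ length xs → γ ≡ 0
      part≡3 {zero}  p _  = refl
      part≡3 {suc γ} p 3≤ = contradiction (≤-trans 3≤ (part-length≤ p (parity ∘ pred ∘ toℕ) λ {u} {v} gu gv eq →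
        Fin.toℕ-injective (nonzero-injective (toℕ u) (toℕ v) gu gv eq))) λ { (s≤s (s≤s ())) }

      g-vertex : ∀ {v : Fin n} {i} → toℕ v ≡ i → g v ≡ ⌊ pred i /2⌋
      g-vertex refl = refl

      At : ℕ → Set
      At i = Σ (Fin n) λ v → toℕ v ≡ i

      nonadj-at : ∀ {i j} (u : At i) (v : At j) → ⌊ pred i /2⌋ ≡ ⌊ pred j /2⌋ → i ≢ j → nonadj G (proj₁ u) (proj₁ v) ≡ true
      nonadj-at (u , u≡) (v , v≡) eq i≢j =
        multipartite-nonadj {g = g} (trans (g-vertex u≡) (trans eq (≡-sym (g-vertex v≡)))) (toℕ-≢ u≡ v≡ i≢j)

      codeg₀ : 2 ≤ codeg G (proj₁ v₀)
      codeg₀ = codeg≥2 G {proj₁ v₀} {proj₁ v₁} {proj₁ v₂} (proj₂ (proj₂ distinct₀₁₂)) (nonadj-at v₀ v₁ refl λ ()) (nonadj-at v₀ v₂ refl λ ())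

      codeg₁ : 2 ≤ codeg G (proj₁ v₁)
      codeg₁ = codeg≥2 G {proj₁ v₁} {proj₁ v₀} {proj₁ v₂} (proj₁ (proj₂ distinct₀₁₂)) (nonadj-at v₁ v₀ refl λ ()) (nonadj-at v₁ v₂ refl λ ())

      codeg₂ : 2 ≤ codeg G (proj₁ v₂)
      codeg₂ = codeg≥2 G {proj₁ v₂} {proj₁ v₀} {proj₁ v₁} (proj₁ distinct₀₁₂) (nonadj-at v₂ v₀ refl λ ()) (nonadj-at v₂ v₁ refl λ ())

      -- Even numbers are paired with their successor (`inj₁`), odd ones with their predecessor
      -- (`inj₂`).
      half-mate : ∀ i → ⌊ i /2⌋ ≡ ⌊ suc i /2⌋ ⊎ ∃ λ j → i ≡ suc j × ⌊ i /2⌋ ≡ ⌊ j /2⌋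
      half-mate zero          = inj₁ refl
      half-mate (suc zero)    = inj₂ (zero , refl , refl)
      half-mate (suc (suc i)) with half-mate i
      ... | inj₁ eq              = inj₁ (cong suc eq)
      ... | inj₂ (j , refl , eq) = inj₂ (suc (suc j) , refl , cong suc eq)

      -- The partner of `v` in its part is a non-neighbour. A partner above `v` is still a vertex
      -- because `v` is not the last one; a partner below always is.
      mate : ∀ v i → toℕ v ≡ suc i → v ≢ proj₁ last → 1 ≤ codeg G v
      mate v i v≡ v≢last with half-mate i
      ... | inj₁ eq = codeg≥1 G v (proj₁ above) (nonadj-at (v , v≡) above eq (≢-sym 1+n≢n))
        where
        i<n : suc i < 3 + m
        i<n = subst₂ _<_ v≡ n≡3+m (Fin.toℕ<n v)
        above : At (2 + i)
        above = vertex (2 + i) n≡3+m (s≤s (≤∧≢⇒< (≤-pred i<n) λ e → v≢last (Fin.toℕ-injective (trans v≡ (trans e (≡-sym (proj₂ last)))))))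
      ... | inj₂ (j , refl , eq) = codeg≥1 G v (proj₁ below) (nonadj-at (v , v≡) below eq 1+n≢n)
        where
        below : At (1 + j)
        below = vertex (1 + j) n≡3+m (≤-trans (n≤1+n _) (subst₂ _<_ v≡ n≡3+m (Fin.toℕ<n v)))

      -- Only the last vertex can lack a non-neighbour, namely when n is even.
      n+3≤1+∑codeg : n + 3 ≤ 1 + sum (codeg G)
      n+3≤1+∑codeg = begin
        n + 3
          ≡⟨ cong₂ _+_ (trans (sum-const n 1) (*-identityʳ n)) (cong₂ _+_ (cong₂ _+_ (sum-δ (proj₁ v₀)) (sum-δ (proj₁ v₁))) (sum-δ (proj₁ v₂))) ⟨
        sum {n} (λ _ → 1) + (sum (δ (proj₁ v₀)) + sum (δ (proj₁ v₁)) + sum (δ (proj₁ v₂)))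
          ≡⟨ cong (sum {n} (λ _ → 1) +_) (∑-distrib-+₃ (δ (proj₁ v₀)) (δ (proj₁ v₁)) (δ (proj₁ v₂))) ⟨
        sum {n} (λ _ → 1) + sum (λ v → δ (proj₁ v₀) v + δ (proj₁ v₁) v + δ (proj₁ v₂) v)
          ≡⟨ ∑-distrib-+ (λ _ → 1) (λ v → δ (proj₁ v₀) v + δ (proj₁ v₁) v + δ (proj₁ v₂) v) ⟨
        sum (λ v → 1 + (δ (proj₁ v₀) v + δ (proj₁ v₁) v + δ (proj₁ v₂) v))
          ≤⟨ sum-mono-≤ pointwise ⟩
        sum (λ v → δ (proj₁ last) v + codeg G v)
          ≡⟨ ∑-distrib-+ (δ (proj₁ last)) (codeg G) ⟩
        sum (δ (proj₁ last)) + sum (codeg G)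
          ≡⟨ cong (_+ sum (codeg G)) (sum-δ (proj₁ last)) ⟩
        1 + sum (codeg G) ∎
        where
        open ≤-Reasoning
        at : ∀ {v} → 2 ≤ codeg G v → 2 ≤ δ (proj₁ last) v + codeg G v
        at {v} h = m≤n⇒m≤o+n (δ (proj₁ last) v) h
        rest : ∀ v i → toℕ v ≡ i → proj₁ v₀ ≢ v → 1 ≤ δ (proj₁ last) v + codeg G v
        rest v zero    v≡ v₀≢v = contradiction (Fin.toℕ-injective (trans (proj₂ v₀) (≡-sym v≡))) v₀≢v
        rest v (suc i) v≡ _ with proj₁ last ≟ v
        ... | yes refl = s≤s z≤n
        ... | no  ne   = mate v i v≡ (ne ∘ ≡-sym)
        pointwise : ∀ v → 1 + (δ (proj₁ v₀) v + δ (proj₁ v₁) v + δ (proj₁ v₂) v) ≤ δ (proj₁ last) v + codeg G v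
        pointwise v with proj₁ v₀ ≟ v | proj₁ v₁ ≟ v | proj₁ v₂ ≟ v
        ... | yes refl | yes eq   | _        = contradiction (≡-sym eq) (proj₁ distinct₀₁₂)
        ... | yes refl | no _     | yes eq   = contradiction (≡-sym eq) (proj₁ (proj₂ distinct₀₁₂))
        ... | no _     | yes refl | yes eq   = contradiction (≡-sym eq) (proj₂ (proj₂ distinct₀₁₂))
        ... | yes refl | no _     | no _     = at codeg₀
        ... | no _     | yes refl | no _     = at codeg₁
        ... | no _     | no _     | yes refl = at codeg₂
        ... | no v₀≢v  | no _     | no _     = rest v (toℕ v) refl v₀≢v

      -- Vertex 0 misses vertices 1 and 2, so its degree is at most n - 3 = m.
      no-more : ¬ HasPacking G (proj₁ v₀) (proj₁ v₁) (proj₁ v₂) (1 + m)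
      no-more p = <-irrefl refl (begin-strict
        2 + m                 <⟨ n<1+n _ ⟩
        3 + m                 ≡⟨ +-comm 2 (1 + m) ⟩
        1 + m + 2             ≤⟨ +-monoˡ-≤ 2 (packing≤deg p (proj₁ distinct₀₁₂)) ⟩
        deg G (proj₁ v₀) + 2  ≤⟨ deg-from-codeg G 2 (proj₁ v₀) n≡3+m codeg₀ ⟩
        2 + m                 ∎)
        where open ≤-Reasoning

      lower : ∀ (G : Graph n) → Lambda3≡ G m → n C 2 ∸ (n + 3) / 2 ≤ edgeCount G
      lower G (pack , _) = ∑codeg≤2*q⇒nC2∸q≤edgeCount G ((n + 3) / 2) (begin
        sum (codeg G)                          ≤⟨ ∑codeg≤n+3 n≡3+m G pack ⟩
        n + 3                                  ≡⟨ m≡m%n+[m/n]*n (n + 3) 2 ⟩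
        (n + 3) % 2 + (n + 3) / 2 * 2          ≤⟨ +-monoˡ-≤ _ (≤-pred (m%n<n (n + 3) 2)) ⟩
        1 + (n + 3) / 2 * 2                    ∎)
        where open ≤-Reasoning

    isG : IsG n m (n C 2 ∸ (n + 3) / 2)
    isG = (G , λ₃ , ≤-antisym (∑codeg≥2*q∸1⇒edgeCount≤nC2∸q G ((n + 3) / 2) (≤-trans (m/n*n≤m (n + 3) 2) n+3≤1+∑codeg)) (lower G λ₃)) , lower
      where
      λ₃ : Lambda3≡ G m
      λ₃ = parts≤3-packing n≡3+m part≤3 part≡3 , proj₁ v₀ , proj₁ v₁ , proj₁ v₂ , distinct₀₁₂ , no-more

-- Stars and connectedness: λ₃ = 1

walk⇒Star : ∀ {n} {G : Graph n} {H : Subgraph G} {u v} → Walk H u v → Star (λ x y → adj G x y ≡ true) u v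
walk⇒Star (here _)           = ε
walk⇒Star {H = H} (step e w) = eInG H _ _ e ◅ walk⇒Star w

module _ (n : ℕ) where

  private
    centre : Fin (suc n) → ℕ
    centre zero    = 0
    centre (suc _) = 1

    G : Graph (suc n)
    G = multipartite centre

    leaf-deg : ∀ v → deg G (suc v) ≡ 1
    leaf-deg v = cong suc (trans (sum-const n 0) (*-zeroʳ n))

    star-size : edgeCount G ≡ n
    star-size = *-cancelˡ-≡ (edgeCount G) n 2 (begin
      2 * edgeCount G                              ≡⟨ handshake G ⟨
      sum {n} (λ _ → 1) + sum (λ v → deg G (suc v))  ≡⟨ cong (sum {n} (λ _ → 1) +_) (sum-cong-≗ leaf-deg) ⟩
      sum {n} (λ _ → 1) + sum {n} (λ _ → 1)        ≡⟨ cong₂ _+_ ones (trans ones (≡-sym (+-identityʳ n))) ⟩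
      2 * n                                        ∎)
      where
      open ≡-Reasoning
      ones : sum {n} (λ _ → 1) ≡ n
      ones = trans (sum-const n 1) (*-identityʳ n)

    from-centre : ∀ v → Star (λ x y → adj G x y ≡ true) zero v
    from-centre zero    = ε
    from-centre (suc v) = refl ◅ ε

    connect : ∀ u v → Star (λ x y → adj G x y ≡ true) u v
    connect u v = reverse (λ {x} {y} e → trans (sym G y x) e) (from-centre u) ◅◅ from-centre v

  -- One tree through every triple makes a graph connected, which costs at least n edges on n + 1
  -- vertices. In the star, a leaf of degree one excludes a second tree.
  star-isG : 2 ≤ n → IsG (suc n) 1 n
  star-isG 2≤n@(s≤s (s≤s _)) = (G , (packing , suc zero , zero , suc (suc zero) , ((λ ()) , (λ ()) , λ ()) , no-more) , star-size) , lower
    where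
    packing : ∀ a b c → Distinct3 a b c → HasPacking G a b c 1
    packing a b c _ = packing-from-connections (λ _ u v → adj G u v ≡ true)
      (λ _ {x} {y} e → trans (sym G y x) e) (λ _ → id) (λ { {zero} {zero} _ _ → refl }) (λ _ → connect a b) (λ _ → connect a c)
    no-more : ¬ HasPacking G (suc zero) zero (suc (suc zero)) 2
    no-more p = contradiction (≤-trans (packing≤deg p (λ ())) (≤-reflexive (leaf-deg zero))) λ { (s≤s ()) }
    lower : ∀ (G : Graph (suc n)) → Lambda3≡ G 1 → n ≤ edgeCount G
    lower G (pack , _) = connected⇒n≤edges G reach
      where
      reach : ∀ v → Star (λ x y → adj G x y ≡ true) zero v
      reach v with zero ≟ v
      ... | yes refl = ε
      ... | no  0≢v with third (s≤s 2≤n) 0≢v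
      ...   | c , distinct with pack zero v c distinct
      ...     | T , st , _ with st zero
      ...       | (conn , _) , 0∈ , v∈ , _ = walk⇒Star (conn zero v 0∈ v∈)

-- Exposes the first entries of a list known only to be long enough, so that literal codes into it
-- evaluate while its tail stays unknown.
prefix : ∀ {A : Set} k (xs : List A) → k ≤ length xs → ∃ λ (v : Vec.Vec A k) → ∃ λ ys → xs ≡ Vec.toList v ++ ys
prefix zero    xs       _        = [] , xs , refl
prefix (suc k) (x ∷ xs) (s≤s k≤) with prefix k xs k≤
... | v , ys , refl = x ∷ v , ys , refl

-- Sharpness: K_{5,6}

module K₅₆ where

  side : Fin 11 → ℕ
  side v = if toℕ v <ᵇ 6 then 0 else 1

  private
    G : Graph 11
    G = multipartite side

    other-side : ∀ {u v} → side u ≢ side v → (side u ≡ 0 × side v ≡ 1) ⊎ (side u ≡ 1 × side v ≡ 0)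
    other-side {u} {v} u≢v with toℕ u <ᵇ 6 | toℕ v <ᵇ 6
    ... | true  | true  = contradiction refl u≢v
    ... | true  | false = inj₁ (refl , refl)
    ... | false | true  = inj₂ (refl , refl)
    ... | false | false = contradiction refl u≢v

    six : ∀ {xs} → Part side 0 xs → 6 ≤ length xs
    six p = part-length≥ p (_↑ˡ 5) (Fin.↑ˡ-injective 5 _ _) (toWitness {a? = Fin.all? λ i → side (i ↑ˡ 5) ℕ.≟ 0} _)

    five : ∀ {xs} → Part side 1 xs → 5 ≤ length xs
    five p = part-length≥ p (6 ↑ʳ_) (Fin.↑ʳ-injective 6 _ _) (toWitness {a? = Fin.all? λ i → side (6 ↑ʳ i) ℕ.≟ 1} _)

    opposite : ∀ u → ∃ λ γ → side u ≢ γ × (∀ {xs} → Part side γ xs → 5 ≤ length xs)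
    opposite u with toℕ u <ᵇ 6
    ... | true  = 1 , (λ ()) , five
    ... | false = 0 , (λ ()) , ≤-trans (n≤1+n 5) ∘ six

    same : ∀ a b c → Distinct3 a b c → side a ≡ side b → side a ≡ side c → HasPacking G a b c 5
    same a b c abc ab ac with part-of₃ {g = side} abc ab ac | opposite a
    ... | xs , p | γ , a≢γ , 5≤ with part-from side γ [] [] (λ ())
    ...   | ys , q with prefix 5 ys (5≤ q)
    ...     | _ ∷ _ ∷ _ ∷ _ ∷ _ ∷ [] , _ , refl = two-parts a≢γ p q p₀ p₁ p₂
      ( (p₀ ∷ q₀ ∷ p₁ ∷ q₀ ∷ p₂ ∷ [])
      ∷ (p₀ ∷ q₁ ∷ p₁ ∷ q₁ ∷ p₂ ∷ [])
      ∷ (p₀ ∷ q₂ ∷ p₁ ∷ q₂ ∷ p₂ ∷ [])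
      ∷ (p₀ ∷ q₃ ∷ p₁ ∷ q₃ ∷ p₂ ∷ [])
      ∷ (p₀ ∷ q₄ ∷ p₁ ∷ q₄ ∷ p₂ ∷ [])
      ∷ []) (m≤m+n 5 _)

    -- There is no slack: at a vertex of S of degree 5 each tree has exactly one edge. If `a` and
    -- `b` have degree 5, the first tree is the path a c b, and every other vertex opposite to them
    -- joins both and reaches `c` through a fresh vertex of their side. If `c` has degree 5, its
    -- five edges start the five trees: two run through `a` and `b` directly, and three go on to a
    -- fresh vertex joined to both.
    pair : ∀ a b c → a ≢ b → side a ≡ side b → side a ≢ side c → HasPacking G a b c 5
    pair a b c a≢b ab ac with part-of₂ {g = side} a≢b ab | part-of {g = side} c | other-side {a} {c} ac
    ... | xs , p | ys , q | inj₁ (a≡0 , c≡1)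
      with prefix 4 xs (≤-pred (≤-pred (six (subst (λ γ → Part side γ (a ∷ b ∷ xs)) a≡0 p))))
         | prefix 4 ys (≤-pred (five (subst (λ γ → Part side γ (c ∷ ys)) c≡1 q)))
    ... | _ ∷ _ ∷ _ ∷ _ ∷ [] , _ , refl | _ ∷ _ ∷ _ ∷ _ ∷ [] , _ , refl = two-parts ac p q p₀ p₁ q₀
      ( (p₀ ∷ q₀ ∷ p₁ ∷ [])
      ∷ (p₀ ∷ q₁ ∷ p₁ ∷ q₁ ∷ p₂ ∷ q₀ ∷ [])
      ∷ (p₀ ∷ q₂ ∷ p₁ ∷ q₂ ∷ p₃ ∷ q₀ ∷ [])
      ∷ (p₀ ∷ q₃ ∷ p₁ ∷ q₃ ∷ p₄ ∷ q₀ ∷ [])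
      ∷ (p₀ ∷ q₄ ∷ p₁ ∷ q₄ ∷ p₅ ∷ q₀ ∷ [])
      ∷ []) (m≤m+n 5 _)
    pair a b c a≢b ab ac | xs , p | ys , q | inj₂ (a≡1 , c≡0)
      with prefix 3 xs (≤-pred (≤-pred (five (subst (λ γ → Part side γ (a ∷ b ∷ xs)) a≡1 p))))
         | prefix 5 ys (≤-pred (six (subst (λ γ → Part side γ (c ∷ ys)) c≡0 q)))
    ... | _ ∷ _ ∷ _ ∷ [] , _ , refl | _ ∷ _ ∷ _ ∷ _ ∷ _ ∷ [] , _ , refl = two-parts ac p q p₀ p₁ q₀
      ( (q₀ ∷ p₀ ∷ q₁ ∷ p₁ ∷ [])
      ∷ (q₀ ∷ p₁ ∷ q₂ ∷ p₀ ∷ [])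
      ∷ (q₀ ∷ p₂ ∷ q₃ ∷ p₀ ∷ q₃ ∷ p₁ ∷ [])
      ∷ (q₀ ∷ p₃ ∷ q₄ ∷ p₀ ∷ q₄ ∷ p₁ ∷ [])
      ∷ (q₀ ∷ p₄ ∷ q₅ ∷ p₀ ∷ q₅ ∷ p₁ ∷ [])
      ∷ []) (m≤m+n 5 _)

    different : ∀ a b c → side a ≢ side b → side a ≢ side c → side b ≢ side c → HasPacking G a b c 5
    different a b c ab ac bc with other-side {a} {b} ab | other-side {a} {c} ac
    ... | inj₁ (_ , b≡1)   | inj₁ (_ , c≡1) = contradiction (trans b≡1 (≡-sym c≡1)) bc
    ... | inj₂ (_ , b≡0)   | inj₂ (_ , c≡0) = contradiction (trans b≡0 (≡-sym c≡0)) bc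
    ... | inj₁ (a≡0 , _)   | inj₂ (a≡1 , _) = contradiction (trans (≡-sym a≡0) a≡1) λ ()
    ... | inj₂ (a≡1 , _)   | inj₁ (a≡0 , _) = contradiction (trans (≡-sym a≡0) a≡1) λ ()

    no-more : ¬ HasPacking G 0F 1F 2F 6
    no-more p = <⇒≱ (n<1+n 5) (packing≤deg p λ ())

  isG : IsG 11 5 (bound 11 5)
  -- The `refl` evaluates both sides to 30: the 5·6 edges of the graph, and the ceiling of 5·6·11 /
  -- 11.
  isG = (G , (by-levels same pair different , 0F , 1F , 2F , ((λ ()) , (λ ()) , λ ()) , no-more) , refl) ,
        λ G (pack , _) → bound≤edgeCount (s≤s (s≤s (s≤s z≤n))) G pack

theorem3 : ((n : ℕ) → 3 ≤ n → IsG n (n ∸ 2) (n C 2 ∸ 1)) ×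
    ((n : ℕ) → 3 ≤ n → IsG n (n ∸ 3) (n C 2 ∸ (n + 3) / 2)) ×
    ((n : ℕ) → 3 ≤ n → IsG n 1 (n ∸ 1)) ×
    ((n ℓ : ℕ) → 11 ≤ n → 1 ≤ ℓ → ℓ ≤ n ∸ 4 →
    (G : Graph n) → Lambda3≡ G ℓ → bound n ℓ ≤ edgeCount G) ×
    Σ ℕ (λ n → Σ ℕ (λ ℓ → 11 ≤ n × 1 ≤ ℓ × ℓ ≤ n ∸ 4 × IsG n ℓ (bound n ℓ)))
theorem3 =
  (λ { (suc (suc (suc m))) (s≤s (s≤s (s≤s z≤n))) → MinusEdge.isG refl }) ,
  (λ { (suc (suc (suc m))) (s≤s (s≤s (s≤s z≤n))) → MinusTriangleAndMatching.isG refl }) ,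
  (λ { (suc n) (s≤s 2≤n) → star-isG n 2≤n }) ,
  (λ n ℓ 11≤n _ _ G (pack , _) → bound≤edgeCount (≤-trans (m≤m+n 3 8) 11≤n) G pack) ,
  11 , 5 , m≤m+n 11 0 , m≤m+n 1 4 , m≤m+n 5 2 , K₅₆.isG
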